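{- Let $r, s, t$ be positive integers. If $\mathcal{B}$ and $\mathcal{B}'$ are valid opposing orientations of $B_r$ and $B_s$ respectively, then $\{\mathcal{B}, \mathcal{B}', TT_t\}$ is $\vec{\chi}$-finite.
   Context: All digraphs are finite, loopless, and between any two distinct vertices at most one of the two possible arcs is present. A digraph $D$ is $H$-free if no induced subdigraph is isomorphic to $H$, and $\mathcal{F}$-free if $H$-free for all $H\in\mathcal{F}$. The dichromatic number $\vec{\chi}(D)$ is the least $k$ such that $V(D)$ can be partitioned into $k$ sets each inducing an acyclic subdigraph. A finite family $\mathcal{F}$ is $\vec{\chi}$-finite if there is $c$ such that every $\mathcal{F}$-free digraph has dichromatic number at most $c$. $TT_t$ is the transitive (acyclic) tournament on $t$ vertices. For an integer $r\ge 1$, the $r$-broom $B_r$ is the undirected graph with vertex set $\{v_1,v_2,v_3,w_1,\dots,w_r\}$ and edges $v_1v_2$, $v_2v_3$, $v_3w_1,\dots,v_3w_r$. An orientation $\mathcal{B}$ of $B_r$ is valid if either all arcs $v_3w_1,\dots,v_3w_r$ are present or all arcs $w_1v_3,\dots,w_rv_3$ are present. An orientation $\mathcal{B}$ of $B_r$ and an orientation $\mathcal{B}'$ of $B_s$ are opposing if $v_2v_3$ is an arc of $\mathcal{B}$ and $v_3v_2$ is an arc of $\mathcal{B}'$. -}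

module Defs where

open import Data.Nat using (ℕ; zero; suc; _+_; _<ᵇ_)
open import Data.Fin using (Fin; zero; suc; toℕ; inject₁; fromℕ; _≟_)
open import Data.Bool using (Bool; true; false; _∨_; if_then_else_)
open import Data.Product using (Σ; ∃; _×_; _,_)
open import Data.Sum using (_⊎_)
open import Relation.Nullary using (¬_; does)
open import Relation.Binary.PropositionalEquality using (_≡_)
open import Function.Definitions using (Injective)

record Digraph (n : ℕ) : Set where
  field
    adj      : Fin n → Fin n → Bool
    loopless : ∀ v → adj v v ≡ false
    oriented : ∀ u v → adj u v ≡ true → adj v u ≡ false
open Digraph public

Arc : ∀ {n} → Digraph n → Fin n → Fin n → Set
Arc D u v = adj D u v ≡ true

InducedIn : ∀ {m n} → Digraph m → Digraph n → Set
InducedIn {m} {n} H D =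
  Σ (Fin m → Fin n) λ f → Injective _≡_ _≡_ f × (∀ i j → adj H i j ≡ adj D (f i) (f j))

Free : ∀ {m n} → Digraph m → Digraph n → Set
Free H D = ¬ InducedIn H D

record CycleIn {n} (D : Digraph n) (P : Fin n → Set) : Set where
  field
    len     : ℕ
    vert    : Fin (suc len) → Fin n
    distinct : Injective _≡_ _≡_ vert
    inP     : ∀ i → P (vert i)
    step    : ∀ (i : Fin len) → Arc D (vert (inject₁ i)) (vert (suc i))
    close   : Arc D (vert (fromℕ len)) (vert zero)

AcyclicOn : ∀ {n} → Digraph n → (Fin n → Set) → Set
AcyclicOn D P = ¬ CycleIn D P

DichromaticAtMost : ∀ {n} → Digraph n → ℕ → Set
DichromaticAtMost {n} D c =
  Σ (Fin n → Fin c) λ col → ∀ (k : Fin c) → AcyclicOn D (λ v → col v ≡ k)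

record AnyDigraph : Set where
  constructor ⟨_,_⟩
  field
    size  : ℕ
    graph : Digraph size

ChiFinite3 : AnyDigraph → AnyDigraph → AnyDigraph → Set
ChiFinite3 ⟨ a , H₁ ⟩ ⟨ b , H₂ ⟩ ⟨ c , H₃ ⟩ =
  ∃ λ (bound : ℕ) → ∀ (n : ℕ) (D : Digraph n) →
    Free H₁ D → Free H₂ D → Free H₃ D → DichromaticAtMost D bound

private
  lt-irr : ∀ (n : ℕ) → (n <ᵇ n) ≡ false
  lt-irr zero = Relation.Binary.PropositionalEquality.refl
  lt-irr (suc n) = lt-irr n

  lt-asym : ∀ (m n : ℕ) → (m <ᵇ n) ≡ true → (n <ᵇ m) ≡ false
  lt-asym zero (suc n) _ = Relation.Binary.PropositionalEquality.refl
  lt-asym (suc m) (suc n) p = lt-asym m n p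

TT : (t : ℕ) → Digraph t
TT t = record
  { adj = λ i j → toℕ i <ᵇ toℕ j
  ; loopless = λ v → lt-irr (toℕ v)
  ; oriented = λ u v p → lt-asym (toℕ u) (toℕ v) p }

-- The r-broom B_r on vertex set Fin (3 + r):
-- 0 = v₁, 1 = v₂, 2 = v₃, 3 + i = w_{i+1}.
v₁ v₂ v₃ : ∀ {r} → Fin (3 + r)
v₁ = zero
v₂ = suc zero
v₃ = suc (suc zero)

w : ∀ {r} → Fin r → Fin (3 + r)
w i = suc (suc (suc i))

broomE : ∀ {r} → Fin (3 + r) → Fin (3 + r) → Bool
broomE zero (suc zero) = true
broomE (suc zero) (suc (suc zero)) = true
broomE (suc (suc zero)) (suc (suc (suc _))) = true
broomE _ _ = false

broomEdge : ∀ {r} → Fin (3 + r) → Fin (3 + r) → Bool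
broomEdge x y = broomE x y ∨ broomE y x

IsBroomOrientation : (r : ℕ) → Digraph (3 + r) → Set
IsBroomOrientation r D = ∀ x y → (adj D x y ∨ adj D y x) ≡ broomEdge x y

Valid : (r : ℕ) → Digraph (3 + r) → Set
Valid r D = (∀ (i : Fin r) → Arc D v₃ (w i)) ⊎ (∀ (i : Fin r) → Arc D (w i) v₃)

Opposing : (r s : ℕ) → Digraph (3 + r) → Digraph (3 + s) → Set
Opposing r s B B' = Arc B v₂ v₃ × Arc B' v₃ v₂

{-# OPTIONS --safe #-}
module Submission where

-- Suppose X is a vertex set in which all neighbourhoods are boundedly coloured (induction on t), and
-- let x v be an arc in the direction prescribed by one of the brooms. If v is nonadjacent to a
-- vertex c with c x oriented like v₁v₂, then by Ramsey v has boundedly many neighbours, in the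
-- direction of the leaves, among the vertices far from c and x. Such "good" vertices can be coloured
-- greedily after the rest: each has a few colours to avoid, and no monochromatic cycle leaves a class.
--
-- Let R be the uncoloured part and Z the vertices with no neighbour in R. Either some cut of X is
-- crossed in one direction only, and both sides are coloured separately, or a directed path leaves
-- Z and comes back; take it to be a geodesic of the breadth-first search from Z. Among vertices of R
-- adjacent to the path and in the same layer of the search, those seeing the path close to the
-- layer's index lie in three neighbourhoods, and the others see only later vertices as in-neighbours
-- and only earlier ones as out-neighbours, so the first such neighbour makes them good. Arcs climb
-- at most one layer, hence two copies of the palette suffice for all layers. Relative to
-- the rest of R, a vertex seen by the path in one direction only is good; for a vertex seen in both
-- directions, all its neighbours in R off the path's neighbourhood are good.

open import Defs
open import Data.Nat using (ℕ; zero; suc; _+_; _∸_; _≤_; _<_; z≤n; s≤s; _≤?_; _<?_; pred) renaming (_≟_ to _≟ℕ_)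
open import Data.Nat.Properties hiding (_≟_; _≤?_; _<?_; suc-injective)
open import Data.Fin using (Fin; zero; suc; toℕ; fromℕ; inject₁; _≟_)
open import Data.Fin.Properties using (any?; suc-injective; toℕ<n; toℕ-injective; +↔⊎; *↔×; 2↔Bool)
open import Data.Bool using (Bool; true; false; not; _∨_; if_then_else_) renaming (_≟_ to _≟ᵇ_)
open import Data.Bool.Properties using (T-≡)
open import Data.Product using (Σ; ∃; _×_; _,_; proj₁; proj₂)
open import Data.Sum using (_⊎_; inj₁; inj₂; map₁) renaming ([_,_] to either)
open import Data.Sum.Properties using (inj₁-injective; inj₂-injective)
open import Data.Empty using (⊥; ⊥-elim)
open import Data.Unit using (⊤; tt)
open import Data.List using (List; []; _∷_; length; filter; _++_; allFin; tabulate; lookup)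
open import Data.List.Properties using (length-tabulate; length-++; filter-notAll)
open import Data.List.Membership.Propositional using (_∈_)
open import Data.List.Membership.Propositional.Properties using (∈-filter⁺; ∈-allFin; ∈-lookup)
open import Data.List.Relation.Unary.Any using (here; there)
open import Data.List.Relation.Unary.All as All using (All; []; _∷_)
import Data.List.Relation.Unary.All.Properties as Allₚ
open import Data.List.Relation.Unary.AllPairs using (AllPairs; []; _∷_)
import Data.List.Relation.Unary.AllPairs.Properties as AllPairsₚ
open import Relation.Binary.Construct.Closure.Transitive using (TransClosure; [_]; _∷_)
open import Relation.Binary.PropositionalEquality using (_≡_; _≢_; refl; sym; trans; cong; cong₂; subst; ≢-sym)
open import Relation.Nullary using (¬_; Dec; yes; no; contradiction; ¬?)
open import Relation.Nullary.Decidable using (_×-dec_; _⊎-dec_; map′)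
open import Relation.Unary using (Pred; Decidable; _⊆_; _∩_; _∪_; ∅)
open import Relation.Binary.Definitions using (tri<; tri≈; tri>)
open import Function using (_∘_; id; Injective; Inverse; Equivalence)
open import Level using (0ℓ)

-- Bounded search for a least witness.

-- The value `m` signals failure: no index below `m` satisfies `Q`.
μ : {Q : ℕ → Set} → Decidable Q → ℕ → ℕ
μ Q? zero = 0
μ Q? (suc m) with Q? 0
... | yes _ = 0
... | no  _ = suc (μ (Q? ∘ suc) m)

μ≤ : {Q : ℕ → Set} (Q? : Decidable Q) (m : ℕ) → μ Q? m ≤ m
μ≤ Q? zero = z≤n
μ≤ Q? (suc m) with Q? 0
... | yes _ = z≤n
... | no  _ = s≤s (μ≤ (Q? ∘ suc) m)

μ-minimal : {Q : ℕ → Set} (Q? : Decidable Q) (m : ℕ) {i : ℕ} → i < μ Q? m → ¬ Q i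
μ-minimal Q? (suc m) {i} i<μ q with Q? 0
μ-minimal Q? (suc m) {zero}  i<μ q       | no ¬q = ¬q q
μ-minimal Q? (suc m) {suc i} (s≤s i<μ) q | no ¬q = μ-minimal (Q? ∘ suc) m i<μ q

μ-holds : {Q : ℕ → Set} (Q? : Decidable Q) (m : ℕ) → μ Q? m < m → Q (μ Q? m)
μ-holds Q? (suc m) μ<m with Q? 0
... | yes q = q
... | no  _ = μ-holds (Q? ∘ suc) m (≤-pred μ<m)

μ-least : {Q : ℕ → Set} (Q? : Decidable Q) (m : ℕ) {i : ℕ} → Q i → μ Q? m ≤ i
μ-least Q? m q = ≮⇒≥ λ i<μ → μ-minimal Q? m i<μ q

μ-hit : {Q : ℕ → Set} (Q? : Decidable Q) (m : ℕ) {i : ℕ} → i < m → Q i → Q (μ Q? m)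
μ-hit Q? m i<m q = μ-holds Q? m (≤-<-trans (μ-least Q? m q) i<m)

least : ∀ {n} {Q : Pred (Fin n) 0ℓ} → Decidable Q → ∃ Q →
        ∃ λ m → Q m × (∀ {i} → toℕ i < toℕ m → ¬ Q i)
least {n} {Q} Q? (i , q) =
  let (m , m≡μ , qm) = μ-hit at? n (toℕ<n i) (i , refl , q)
  in m , qm , λ i<m qi → μ-minimal at? n (subst (_ <_) m≡μ i<m) (_ , refl , qi)
  where
  at? : Decidable (λ j → ∃ λ i → toℕ i ≡ j × Q i)
  at? j = any? λ i → (toℕ i ≟ℕ j) ×-dec Q? i

-- Acyclic relations, by fibres and by levels.

Acyclic : {V : Set} → (V → V → Set) → Set
Acyclic R = ∀ v → ¬ TransClosure R v v

module _ {V : Set} where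

  mapTC : {R Q : V → V → Set} → (∀ {u v} → R u v → Q u v) →
          ∀ {u v} → TransClosure R u v → TransClosure Q u v
  mapTC f [ r ] = [ f r ]
  mapTC f (r ∷ rs) = f r ∷ mapTC f rs

  Acyclic-⊆ : {R Q : V → V → Set} → (∀ {u v} → R u v → Q u v) → Acyclic Q → Acyclic R
  Acyclic-⊆ f acyc v = acyc v ∘ mapTC f

  module _ {R : V → V → Set} where

    Acyclic-fibres : {C : Set} (q : V → C) → (∀ {u v} → R u v → q u ≡ q v) →
                     (∀ c → Acyclic (λ u v → R u v × q u ≡ c × q v ≡ c)) → Acyclic R
    Acyclic-fibres q const acyc v loop = acyc (q v) v (go refl loop)
      where
      go : ∀ {u w c} → q u ≡ c → TransClosure R u w →
           TransClosure (λ u v → R u v × q u ≡ c × q v ≡ c) u w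
      go e [ r ] = [ r , e , trans (sym (const r)) e ]
      go e (r ∷ rs) = let e′ = trans (sym (const r)) e in (r , e , e′) ∷ go e′ rs

    -- A function that never increases along arcs is constant on every cycle.
    Acyclic-levels : (p : V → ℕ) → (∀ {u v} → R u v → p v ≤ p u) →
                     (∀ i → Acyclic (λ u v → R u v × p u ≡ i × p v ≡ i)) → Acyclic R
    Acyclic-levels p anti acyc v loop = acyc (p v) v (go ≤-refl refl loop)
      where
      anti⁺ : ∀ {u w} → TransClosure R u w → p w ≤ p u
      anti⁺ [ r ] = anti r
      anti⁺ (r ∷ rs) = ≤-trans (anti⁺ rs) (anti r)

      go : ∀ {u w i} → i ≤ p w → p u ≡ i → TransClosure R u w →
           TransClosure (λ u v → R u v × p u ≡ i × p v ≡ i) u w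
      go i≤ e [ r ] = [ r , e , ≤-antisym (≤-trans (anti r) (≤-reflexive e)) i≤ ]
      go i≤ e (r ∷ rs) =
        let e′ = ≤-antisym (≤-trans (anti r) (≤-reflexive e)) (≤-trans i≤ (anti⁺ rs))
        in (r , e , e′) ∷ go i≤ e′ rs

  -- The reflection `K ∸ p` turns increase into decrease; the bound `p≤K` makes truncated
  -- subtraction invertible.
  Acyclic-levels⁻ : {R : V → V → Set} (p : V → ℕ) (K : ℕ) → (∀ v → p v ≤ K) →
                    (∀ {u v} → R u v → p u ≤ p v) →
                    (∀ i → Acyclic (λ u v → R u v × p u ≡ i × p v ≡ i)) → Acyclic R
  Acyclic-levels⁻ p K p≤K mono acyc =
    Acyclic-levels (λ v → K ∸ p v) (λ r → ∸-monoʳ-≤ K (mono r)) λ i →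
      Acyclic-⊆ (λ {u} {v} (r , eu , ev) → r , back u eu , back v ev) (acyc (K ∸ i))
    where
    back : ∀ v {i} → K ∸ p v ≡ i → p v ≡ K ∸ i
    back v refl = sym (m∸[m∸n]≡n (p≤K v))

-- Finite palettes.

Embeds : Set → Set
Embeds A = ∃ λ k → Σ (A → Fin k) (Injective _≡_ _≡_)

module _ {A B : Set} where

  Embeds-⊎ : Embeds A → Embeds B → Embeds (A ⊎ B)
  Embeds-⊎ (k , f , f-inj) (l , g , g-inj) = k + l , from ∘ fg , fg-inj ∘ from-inj
    where
    open Inverse (+↔⊎ {k} {l}) using (to; from; strictlyInverseˡ)
    fg : A ⊎ B → Fin k ⊎ Fin l
    fg (inj₁ a) = inj₁ (f a)
    fg (inj₂ b) = inj₂ (g b)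
    fg-inj : Injective _≡_ _≡_ fg
    fg-inj {inj₁ _} {inj₁ _} e = cong inj₁ (f-inj (inj₁-injective e))
    fg-inj {inj₂ _} {inj₂ _} e = cong inj₂ (g-inj (inj₂-injective e))
    from-inj : Injective _≡_ _≡_ from
    from-inj {x} {y} e = trans (sym (strictlyInverseˡ x)) (trans (cong to e) (strictlyInverseˡ y))

  Embeds-× : Embeds A → Embeds B → Embeds (A × B)
  Embeds-× (k , f , f-inj) (l , g , g-inj) =
    k Data.Nat.* l , (λ (a , b) → from (f a , g b)) , λ e → both (from-inj e)
    where
    open Inverse (*↔× {k} {l}) using (to; from; strictlyInverseˡ)
    from-inj : Injective _≡_ _≡_ from
    from-inj {x} {y} e = trans (sym (strictlyInverseˡ x)) (trans (cong to e) (strictlyInverseˡ y))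
    both : ∀ {a a′ b b′} → (f a , g b) ≡ (f a′ , g b′) → (a , b) ≡ (a′ , b′)
    both e = cong₂ _,_ (f-inj (cong proj₁ e)) (g-inj (cong proj₂ e))

Embeds-Fin : ∀ {k} → Embeds (Fin k)
Embeds-Fin = _ , id , id

Embeds-⊤ : Embeds ⊤
Embeds-⊤ = 1 , (λ _ → zero) , λ _ → refl

Embeds-Bool : Embeds Bool
Embeds-Bool = 2 , Inverse.from 2↔Bool , λ {x} {y} e →
  trans (sym (Inverse.strictlyInverseˡ 2↔Bool x))
        (trans (cong (Inverse.to 2↔Bool) e) (Inverse.strictlyInverseˡ 2↔Bool y))

-- Size bounds for vertex sets.

module _ {n : ℕ} where

  -- The list may repeat vertices or leave `X`, so this is only an upper bound on the size. It is
  -- the fuel of the recursions in `search`, `peel` and `colour`.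
  infix 4 _⊑_
  _⊑_ : Pred (Fin n) 0ℓ → ℕ → Set
  X ⊑ k = Σ (List (Fin n)) λ xs → length xs ≤ k × (∀ {v} → X v → v ∈ xs)

  ⊑-full : ∀ X → X ⊑ n
  ⊑-full X = allFin n , ≤-reflexive (length-tabulate id) , λ {v} _ → ∈-allFin v

  ⊑-zero : ∀ {X v} → X ⊑ 0 → ¬ X v
  ⊑-zero (x ∷ xs , () , _)
  ⊑-zero ([] , _ , cov) x with cov x
  ... | ()

  ⊑-shrink : ∀ {X Y k v} → X ⊑ suc k → X v → Y ⊆ X → ¬ Y v → Y ⊑ k
  ⊑-shrink {Y = Y} {v = v} (xs , len , cov) xv Y⊆X ¬yv =
    filter ≢v? xs ,
    ≤-pred (≤-trans (filter-notAll ≢v? xs (drop (cov xv))) len) ,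
    λ {w} y → ∈-filter⁺ ≢v? (cov (Y⊆X y)) λ { refl → ¬yv y }
    where
    ≢v? : Decidable (_≢ v)
    ≢v? w = ¬? (w ≟ v)
    drop : ∀ {ys} → v ∈ ys → Data.List.Relation.Unary.Any.Any (λ w → ¬ (w ≢ v)) ys
    drop (here refl) = here λ ne → ne refl
    drop (there i) = there (drop i)

-- PathColour: the parity of the layer, then one of three neighbourhoods of path vertices or a greedy
-- colour from the palette of either broom.
-- FarColour: greedy colours on the left, the private colours of mixed vertices on the right.
Palette PathColour FarColour FullColour : Set → ℕ → Set
Palette A N = Bool × A × Fin N
PathColour A N = Bool × (A ⊎ A ⊎ A ⊎ (Palette A N ⊎ ⊤) ⊎ (Palette A N ⊎ ⊤))
FarColour A N = Palette (PathColour A N) N ⊎ PathColour A N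
FullColour A N = FarColour A N ⊎ A ⊎ ⊤

Embeds-FullColour : ∀ {A N} → Embeds A → Embeds (FullColour A N)
Embeds-FullColour {A} {N} emb =
  Embeds-⊎ (Embeds-⊎ (palette path) path) (Embeds-⊎ emb Embeds-⊤)
  where
  palette : ∀ {B} → Embeds B → Embeds (Palette B N)
  palette emb = Embeds-× Embeds-Bool (Embeds-× emb Embeds-Fin)
  side : Embeds (Palette A N ⊎ ⊤)
  side = Embeds-⊎ (palette emb) Embeds-⊤
  path : Embeds (PathColour A N)
  path = Embeds-× Embeds-Bool
    (Embeds-⊎ emb (Embeds-⊎ emb (Embeds-⊎ emb (Embeds-⊎ side side))))

-- Acyclic colourings of vertex sets.

-- Throughout, a Boolean records a direction: arc true is Arc and arc false its converse.
module Colouring {n : ℕ} (D : Digraph n) where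

  V : Set
  V = Fin n

  arc : Bool → V → V → Set
  arc true  u v = Arc D u v
  arc false u v = Arc D v u

  arc? : ∀ b u v → Dec (arc b u v)
  arc? true  u v = adj D u v ≟ᵇ true
  arc? false u v = adj D v u ≟ᵇ true

  arc-sym : ∀ b {u v} → arc b u v → arc (not b) v u
  arc-sym true  a = a
  arc-sym false a = a

  Adj : V → V → Set
  Adj u v = ∃ λ b → arc b u v

  Adj? : ∀ u v → Dec (Adj u v)
  Adj? u v = map′ (either (true ,_) (false ,_))
                  (λ { (true , a) → inj₁ a ; (false , a) → inj₂ a })
                  (arc? true u v ⊎-dec arc? false u v)

  Adj-sym : ∀ {u v} → Adj u v → Adj v u
  Adj-sym (b , a) = not b , arc-sym b a

  ¬Adj : ∀ b {u v} → ¬ arc b u v → ¬ arc (not b) u v → ¬ Adj u v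
  ¬Adj true  ¬a ¬a′ (true  , a) = ¬a a
  ¬Adj true  ¬a ¬a′ (false , a) = ¬a′ a
  ¬Adj false ¬a ¬a′ (true  , a) = ¬a′ a
  ¬Adj false ¬a ¬a′ (false , a) = ¬a a

  Mono : {A : Set} → Pred V 0ℓ → (V → A) → V → V → Set
  Mono X f u v = X u × X v × f u ≡ f v × Arc D u v

  Col : Pred V 0ℓ → Set → Set
  Col X A = Σ (V → A) λ f → Acyclic (Mono X f)

  module _ {X : Pred V 0ℓ} {A : Set} where

    Mono-⊆ : ∀ {Y f} → Y ⊆ X → ∀ {u v} → Mono {A} Y f u v → Mono X f u v
    Mono-⊆ Y⊆X (yu , yv , e , a) = Y⊆X yu , Y⊆X yv , e , a

    Col-⊆ : ∀ {Y} → Y ⊆ X → Col X A → Col Y A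
    Col-⊆ Y⊆X (f , acyc) = f , Acyclic-⊆ (Mono-⊆ Y⊆X) acyc

    Col-map : ∀ {B} (φ : A → B) → Injective _≡_ _≡_ φ → Col X A → Col X B
    Col-map φ φ-inj (f , acyc) =
      φ ∘ f , Acyclic-⊆ (λ (xu , xv , e , a) → xu , xv , φ-inj e , a) acyc

    Col-∪ : ∀ {Y B} → Decidable X → Col X A → Col Y B → Col (X ∪ Y) (A ⊎ B)
    Col-∪ {Y} {B} X? (f , f-acyc) (g , g-acyc) = h , Acyclic-fibres h (λ (_ , _ , e , _) → e) class
      where
      h : V → A ⊎ B
      h v with X? v
      ... | yes _ = inj₁ (f v)
      ... | no  _ = inj₂ (g v)

      left : ∀ {v a} → h v ≡ inj₁ a → X v × f v ≡ a
      left {v} e with X? v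
      left refl | yes x = x , refl

      right : ∀ {v b} → (X ∪ Y) v → h v ≡ inj₂ b → Y v × g v ≡ b
      right {v} xy e with X? v
      right (inj₁ x) e    | no ¬x = contradiction x ¬x
      right (inj₂ y) refl | no ¬x = y , refl

      class : ∀ c → Acyclic (λ u v → Mono (X ∪ Y) h u v × h u ≡ c × h v ≡ c)
      class (inj₁ a) = Acyclic-⊆ (λ ((_ , _ , _ , arc) , eu , ev) →
        let (xu , fu) = left eu ; (xv , fv) = left ev in xu , xv , trans fu (sym fv) , arc) f-acyc
      class (inj₂ b) = Acyclic-⊆ (λ ((u , v , _ , arc) , eu , ev) →
        let (yu , gu) = right u eu ; (yv , gv) = right v ev in yu , yv , trans gu (sym gv) , arc) g-acyc

    -- No cycle uses both sides, so one palette serves for both: `side` cannot rise along an arc.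
    Col-split : ∀ {Q} → Decidable Q → (∀ {u v} → (X ∩ Q) u → X v → ¬ Q v → ¬ Arc D u v) →
                Col (X ∩ Q) A → Col (λ v → X v × ¬ Q v) A → Col X A
    Col-split {Q} Q? no-arc (f , f-acyc) (g , g-acyc) =
      h , Acyclic-levels side antitone level
      where
      h : V → A
      h v with Q? v
      ... | yes _ = f v
      ... | no  _ = g v

      side : V → ℕ
      side v with Q? v
      ... | yes _ = 0
      ... | no  _ = 1

      antitone : ∀ {u v} → Mono X h u v → side v ≤ side u
      antitone {u} {v} (xu , xv , _ , a) with Q? u | Q? v
      ... | yes q | yes _ = z≤n
      ... | yes q | no ¬q = contradiction a (no-arc (xu , q) xv ¬q)
      ... | no _  | yes _ = z≤n
      ... | no _  | no _  = ≤-refl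

      in-Q : ∀ {v} → side v ≡ 0 → Q v × h v ≡ f v
      in-Q {v} e with Q? v
      ... | yes q = q , refl
      in-Q () | no _

      out-Q : ∀ {v i} → side v ≡ suc i → ¬ Q v × h v ≡ g v
      out-Q {v} e with Q? v
      ... | no ¬q = ¬q , refl
      out-Q () | yes _

      level : ∀ i → Acyclic (λ u v → Mono X h u v × side u ≡ i × side v ≡ i)
      level zero = Acyclic-⊆ (λ ((xu , xv , e , a) , eu , ev) →
        let (qu , hu) = in-Q eu ; (qv , hv) = in-Q ev
        in (xu , qu) , (xv , qv) , trans (sym hu) (trans e hv) , a) f-acyc
      level (suc i) = Acyclic-⊆ (λ ((xu , xv , e , a) , eu , ev) →
        let (qu , hu) = out-Q eu ; (qv , hv) = out-Q ev
        in (xu , qu) , (xv , qv) , trans (sym hu) (trans e hv) , a) g-acyc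

    -- With the parity of the layer in the colour, a monochromatic arc cannot climb exactly one
    -- layer. Hence it never climbs, a monochromatic cycle stays in a single layer, and all layers
    -- may share the palette `A`.
    Col-layers : (d : V → ℕ) → (∀ {u v} → X u → X v → Arc D u v → d v ≤ suc (d u)) →
                 (∀ i → Col (λ v → X v × d v ≡ i) A) → Col X (Bool × A)
    Col-layers d d-step layer =
      h , Acyclic-levels d antitone λ i → Acyclic-⊆
        (λ { ((xu , xv , e , a) , refl , ev) →
             (xu , refl) , (xv , ev) , trans (cong proj₂ e) (cong (λ j → proj₁ (layer j) _) ev) , a })
        (proj₂ (layer i))
      where
      even : ℕ → Bool
      even zero = true
      even (suc i) = not (even i)

      not-fixed : ∀ {b} → b ≢ not b
      not-fixed {true} ()
      not-fixed {false} ()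

      h : V → Bool × A
      h v = even (d v) , proj₁ (layer (d v)) v

      antitone : ∀ {u v} → Mono X h u v → d v ≤ d u
      antitone {u} {v} (xu , xv , e , a) with m≤n⇒m<n∨m≡n (d-step xu xv a)
      ... | inj₁ (s≤s dv≤du) = dv≤du
      ... | inj₂ dv≡1+du = contradiction (trans (cong proj₁ e) (cong even dv≡1+du)) not-fixed

  -- seq true runs through x₀, …, x_{k+1} with x₀, x_{k+1} in Z, and seq false is the
  -- same path traversed backwards; d is the (truncated) distance from Z.
  record Geodesic (X Z : Pred V 0ℓ) : Set where
    field
      k      : ℕ
      d      : V → ℕ
      seq    : Bool → ℕ → V
      seq∈X  : ∀ b i → X (seq b i)
      flip   : ∀ b {i j} → i + j ≡ suc k → seq b i ≡ seq (not b) j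
      step   : ∀ b {i} → i ≤ k → arc b (seq b i) (seq b (suc i))
      end    : ∀ b → Z (seq b 0)
      leave  : ¬ Z (seq true 1)
      d-seq  : ∀ {i} → i ≤ k → d (seq true i) ≡ i
      d-step : ∀ {u v} → X u → X v → Arc D u v → d v ≤ suc (d u)

  -- Both sides are nonempty, so each is smaller than `X` and can be coloured recursively.
  record OneWayCut (X : Pred V 0ℓ) : Set₁ where
    field
      Q      : Pred V 0ℓ
      Q?     : Decidable Q
      inside  : ∃ λ v → X v × Q v
      outside : ∃ λ v → X v × ¬ Q v
      no-arc : ∀ {u v} → (X ∩ Q) u → X v → ¬ Q v → ¬ Arc D u v

-- Breadth-first search from a vertex set.

module _ {n : ℕ} (D : Digraph n) where
  open Colouring D

  module Search {X Z : Pred V 0ℓ} (X? : Decidable X) (Z? : Decidable Z) (Z⊆X : Z ⊆ X)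
    (Z-nonempty : ∃ Z) (Z-proper : ∃ λ v → X v × ¬ Z v) where

    Reach : ℕ → Pred V 0ℓ
    Reach zero v = Z v
    Reach (suc m) v = Reach m v ⊎ (X v × ∃ λ u → Reach m u × Arc D u v)

    Reach? : ∀ m → Decidable (Reach m)
    Reach? zero = Z?
    Reach? (suc m) v =
      Reach? m v ⊎-dec (X? v ×-dec any? λ u → Reach? m u ×-dec arc? true u v)

    Reach⊆X : ∀ m → Reach m ⊆ X
    Reach⊆X zero z = Z⊆X z
    Reach⊆X (suc m) (inj₁ r) = Reach⊆X m r
    Reach⊆X (suc m) (inj₂ (xv , _)) = xv

    First : ℕ → Pred V 0ℓ
    First j v = Reach j v × (∀ {i} → i < j → ¬ Reach i v)

    -- The path is traced from `v` back to `Z`, against the arcs. Values of `y` beyond index `j` are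
    -- padding inside `X`.
    path : ∀ j {v} → First j v → ∃ λ (y : ℕ → V) → y 0 ≡ v × (∀ i → X (y i)) ×
           (∀ {i} → i < j → Arc D (y (suc i)) (y i)) × (∀ {i i′} → i + i′ ≡ j → First i′ (y i))
    path zero {v} f = (λ _ → v) , refl , (λ _ → Z⊆X (proj₁ f)) , (λ ()) , λ { {zero} refl → f }
    path (suc j) {v} (inj₁ r , ¬r) = contradiction r (¬r ≤-refl)
    path (suc j) {v} f@(inj₂ (xv , u , r , a) , ¬r)
      -- An earlier arrival at `u` would give an earlier arrival at `v`, so `u` is first reached at
      -- `j`.
      with path j (r , λ i<j ru → ¬r (s≤s i<j) (inj₂ (xv , u , ru , a)))
    ... | y , refl , y∈X , arcs , firsts = y′ , refl , y′∈X , arcs′ , firsts′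
      where
      y′ : ℕ → V
      y′ zero = v
      y′ (suc i) = y i
      y′∈X : ∀ i → X (y′ i)
      y′∈X zero = xv
      y′∈X (suc i) = y∈X i
      arcs′ : ∀ {i} → i < suc j → Arc D (y′ (suc i)) (y′ i)
      arcs′ {zero} _ = a
      arcs′ {suc i} (s≤s i<j) = arcs i<j
      firsts′ : ∀ {i i′} → i + i′ ≡ suc j → First i′ (y′ i)
      firsts′ {zero} refl = f
      firsts′ {suc i} e = firsts (cong pred e)

    -- The distance is cut off at m + 1, since the search stops as soon as it meets an arc back to Z.
    module _ (m : ℕ) where

      dist : V → ℕ
      dist v = μ (λ j → Reach? j v) (suc m)

      -- If `dist v` exceeded `dist u + 1`, then `dist u` would lie below the cut-off and be
      -- attained, which puts `v` within reach one step later.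
      dist-step : ∀ {u v} → X u → X v → Arc D u v → dist v ≤ suc (dist u)
      dist-step {u} {v} _ xv a = ≮⇒≥ λ lt →
        μ-minimal (λ j → Reach? j v) (suc m) lt
          (inj₂ (xv , u , μ-holds (λ j → Reach? j u) (suc m)
            (<-trans (n<1+n _) (<-≤-trans lt (μ≤ _ (suc m)))) , a))

      dist-first : ∀ {j v} → j ≤ m → First j v → dist v ≡ j
      dist-first {j} {v} j≤m (r , ¬r) = ≤-antisym (μ-least Q? (suc m) r)
        (≮⇒≥ λ lt → ¬r lt (μ-hit Q? (suc m) (s≤s j≤m) r))
        where
        Q? : Decidable (λ j → Reach j v)
        Q? j = Reach? j v

      first-reach : ∀ {v} → Reach m v → ∃ λ k → k ≤ m × First k v
      first-reach {v} r = dist v , μ-least Q? (suc m) r , μ-hit Q? (suc m) ≤-refl r , μ-minimal Q? (suc m)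
        where
        Q? : Decidable (λ j → Reach j v)
        Q? j = Reach? j v

      geodesic : ∀ {x z} → Reach m x → ¬ Z x → Z z → Arc D x z → Geodesic X Z
      geodesic {x} {z} r ¬z z∈Z a with first-reach r
      ... | zero , _ , x∈Z , _ = contradiction x∈Z ¬z
      ... | suc k , k≤m , f with path (suc k) f
      ... | y , refl , y∈X , arcs , firsts = record
        { k = suc k ; d = dist ; seq = seq ; seq∈X = seq∈X ; flip = flip ; step = step
        ; end = end ; leave = proj₂ (firsts {k} (+-comm k 1)) (s≤s z≤n)
        ; d-seq = d-seq ; d-step = dist-step }
        where
        K : ℕ
        K = suc (suc k)

        -- `y′` starts with the endpoint `z` in `Z` and runs against the arcs; `seq true` is its
        -- reversal.
        y′ : ℕ → V
        y′ zero = z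
        y′ (suc i) = y i

        y′∈X : ∀ i → X (y′ i)
        y′∈X zero = Z⊆X z∈Z
        y′∈X (suc i) = y∈X i

        seq : Bool → ℕ → V
        seq true i = y′ (K ∸ i)
        seq false i = y′ i

        seq∈X : ∀ b i → X (seq b i)
        seq∈X true i = y′∈X (K ∸ i)
        seq∈X false i = y′∈X i

        flip : ∀ b {i j} → i + j ≡ K → seq b i ≡ seq (not b) j
        flip true {i} {j} e = cong y′ (trans (cong (_∸ i) (sym e)) (m+n∸m≡n i j))
        flip false {i} {j} e = cong y′ (sym (trans (cong (_∸ j) (sym e)) (m+n∸n≡m i j)))

        back : ∀ {i} → i ≤ suc k → Arc D (y′ (suc i)) (y′ i)
        back {zero} _ = a
        back {suc i} i≤k = arcs i≤k

        step : ∀ b {i} → i ≤ suc k → arc b (seq b i) (seq b (suc i))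
        step true {i} i≤k =
          subst (λ j → Arc D (y′ j) (y′ (suc k ∸ i))) (sym (+-∸-assoc 1 i≤k)) (back (m∸n≤m (suc k) i))
        step false = back

        end : ∀ b → Z (seq b 0)
        end true = proj₁ (firsts (+-identityʳ (suc k)))
        end false = z∈Z

        d-seq : ∀ {i} → i ≤ suc k → dist (seq true i) ≡ i
        d-seq {i} i≤k =
          trans (cong (dist ∘ y′) (+-∸-assoc 1 i≤k))
                (dist-first (≤-trans i≤k k≤m) (firsts (m∸n+n≡m i≤k)))

    -- The reached set grows until an arc returns to `Z` from a reached vertex outside `Z`, which
    -- closes a path, or until no arc leaves the reached set. In the latter case no arc leaves its
    -- part outside `Z`, or, if that part is empty, no arc leaves `Z` itself.
    search : ∀ fuel m → (λ v → X v × ¬ Reach m v) ⊑ fuel → Geodesic X Z ⊎ OneWayCut X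
    search fuel m bound
      with any? (λ x → Reach? m x ×-dec (¬? (Z? x) ×-dec any? λ z → Z? z ×-dec arc? true x z))
    ... | yes (x , r , ¬z , z , z∈Z , a) = inj₁ (geodesic m r ¬z z∈Z a)
    ... | no ¬return
      with any? (λ u → Reach? m u ×-dec any? λ v → X? v ×-dec (¬? (Reach? m v) ×-dec arc? true u v))
    ... | yes (u , r , v , xv , ¬r , a) = next fuel bound
      where
      next : ∀ fuel → (λ v → X v × ¬ Reach m v) ⊑ fuel → Geodesic X Z ⊎ OneWayCut X
      next zero bound = contradiction (xv , ¬r) (⊑-zero bound)
      next (suc fuel) bound = search fuel (suc m)
        (⊑-shrink bound (xv , ¬r) (λ (xw , ¬rw) → xw , ¬rw ∘ inj₁)
          λ (_ , ¬rv) → ¬rv (inj₂ (xv , u , r , a)))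
    ... | no ¬leave with any? (λ q → Reach? m q ×-dec ¬? (Z? q))
    ... | yes (q , r , ¬z) = inj₂ record
      { Q = λ v → Reach m v × ¬ Z v ; Q? = λ v → Reach? m v ×-dec ¬? (Z? v)
      ; inside = q , Reach⊆X m r , r , ¬z
      ; outside = let (z , z∈Z) = Z-nonempty in z , Z⊆X z∈Z , λ (_ , ¬z) → ¬z z∈Z
      ; no-arc = no-arc }
      where
      no-arc : ∀ {u v} → (X ∩ (λ v → Reach m v × ¬ Z v)) u → X v → ¬ (Reach m v × ¬ Z v) → ¬ Arc D u v
      no-arc {u} {v} (_ , ru , ¬zu) xv ¬qv a with Reach? m v | Z? v
      ... | no ¬rv | _      = ¬leave (u , ru , v , xv , ¬rv , a)
      ... | yes rv | yes zv = ¬return (u , ru , ¬zu , v , zv , a)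
      ... | yes rv | no ¬zv = ¬qv (rv , ¬zv)
    ... | no ¬q = inj₂ record
      { Q = Reach m ; Q? = Reach? m
      ; inside = let (z , z∈Z) = Z-nonempty in z , Z⊆X z∈Z , Z⊆Reach m z∈Z
      ; outside = let (v , xv , ¬zv) = Z-proper in v , xv , λ r → ¬q (v , r , ¬zv)
      ; no-arc = λ (_ , ru) xv ¬rv a → ¬leave (_ , ru , _ , xv , ¬rv , a) }
      where
      Z⊆Reach : ∀ m → Z ⊆ Reach m
      Z⊆Reach zero z = z
      Z⊆Reach (suc m) z = inj₁ (Z⊆Reach m z)

-- Greedy extension of a colouring.

-- l b is the direction of the leaf arcs of broom b, seen from v₃; below, e b is that of v₁v₂.
module Greedy {n : ℕ} (D : Digraph n) (l : Bool → Bool) (N : ℕ) where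
  open Colouring D

  -- The bound is the absence of an injection from `Fin N`, since such an injection is what arises
  -- when none of the `N` indices is free.
  record Good (b : Bool) (v : V) (Y : Pred V 0ℓ) : Set where
    constructor few-neighbours
    field
      bounded : ¬ ∃ λ (f : Fin N → V) → Injective _≡_ _≡_ f × (∀ j → Y (f j) × arc (l b) v (f j))

  Good-⊆ : ∀ {b v Y Y′} → Y′ ⊆ Y → Good b v Y → Good b v Y′
  Good-⊆ Y′⊆Y (few-neighbours bounded) = few-neighbours λ (f , f-inj , h) →
    bounded (f , f-inj , λ j → Y′⊆Y (proj₁ (h j)) , proj₂ (h j))

  record Extension {M : Set} (S R : Pred V 0ℓ) (col₀ : V → M) : Set where
    field
      col     : V → M
      old     : ∀ {v} → ¬ S v → col v ≡ col₀ v
      acyclic : Acyclic (Mono (S ∪ R) col)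

module _ {n : ℕ} (D : Digraph n) (l : Bool → Bool) (N : ℕ) where
  open Colouring D
  open Greedy D l N

  -- Vertices of `S` are coloured from the largest value of `p` down. Each takes its direction
  -- `β v`, the colour `g v` and an index missed by its later neighbours in direction `l (β v)`. Of
  -- the neighbours in `R`, `good` counts only those coloured by `inj₁`, as `inj₂` carries no index.
  module Extend {A E : Set} {S R : Pred V 0ℓ} (S? : Decidable S) (R? : Decidable R)
    (disjoint : ∀ {v} → S v → ¬ R v)
    (p : V → ℕ) (K : ℕ) (p<K : ∀ {v} → S v → p v < K)
    (g : V → A) (g-acyclic : ∀ i → Acyclic (Mono (λ v → S v × p v ≡ i) g))
    (col₀ : V → Palette A N ⊎ E) (col₀-acyclic : Acyclic (Mono R col₀))
    (good : ∀ {v} → S v → ∃ λ b →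
      Good b v (λ w → (R w × ∃ λ a → col₀ w ≡ inj₁ a) ⊎ (S w × p v < p w)))
    where

    M : Set
    M = Palette A N ⊎ E

    β : V → Bool
    β v with S? v
    ... | yes s = proj₁ (good s)
    ... | no  _ = true

    good-β : ∀ {v} → S v → Good (β v) v (λ w → (R w × ∃ λ a → col₀ w ≡ inj₁ a) ⊎ (S w × p v < p w))
    good-β {v} s with S? v
    ... | yes s′ = proj₂ (good s′)
    ... | no ¬s  = contradiction s ¬s

    HasIndex : Fin N → M → Set
    HasIndex j m = ∃ λ b → ∃ λ a → m ≡ inj₁ (b , a , j)

    HasIndex? : ∀ j m → Dec (HasIndex j m)
    HasIndex? j (inj₁ (b , a , i)) = map′ (λ { refl → b , a , refl }) (λ { (_ , _ , refl) → refl }) (i ≟ j)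
    HasIndex? j (inj₂ _) = no λ { (_ , _ , ()) }

    HasIndex-unique : ∀ {i j m} → HasIndex i m → HasIndex j m → i ≡ j
    HasIndex-unique (_ , _ , refl) (_ , _ , refl) = refl

    Later : V → V → Set
    Later v w = R w ⊎ (S w × p v < p w)

    Later? : ∀ v w → Dec (Later v w)
    Later? v w = R? w ⊎-dec (S? w ×-dec (p v <? p w))

    record Stage (i : ℕ) : Set where
      field
        col   : V → M
        old   : ∀ {v} → ¬ (S v × i ≤ p v) → col v ≡ col₀ v
        new   : ∀ {v} → S v → i ≤ p v → ∃ λ j → col v ≡ inj₁ (β v , g v , j)
        avoid : ∀ {v w j} → S v → i ≤ p v → Later v w → arc (l (β v)) v w →
                HasIndex j (col v) → ¬ HasIndex j (col w)

    step : ∀ {i} → Stage (suc i) → Stage i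
    step {i} st = record { col = col′ ; old = old′ ; new = new′ ; avoid = avoid′ }
      where
      open Stage st

      Hit : V → Fin N → V → Set
      Hit v j w = Later v w × arc (l (β v)) v w × HasIndex j (col w)

      Hit? : ∀ v j w → Dec (Hit v j w)
      Hit? v j w = Later? v w ×-dec (arc? (l (β v)) v w ×-dec HasIndex? j (col w))

      -- If every index were hit, one hit for each would give `N` distinct vertices, since a colour
      -- has only one index.
      fresh : ∀ {v} → S v → p v ≡ i → ∃ λ j → ¬ ∃ (Hit v j)
      fresh {v} s _ with any? (λ j → ¬? (any? (Hit? v j)))
      ... | yes found = found
      ... | no ¬found = ⊥-elim (Good.bounded (good-β s) (hitter , hitter-inj , λ j →
          target (hit j) , proj₁ (proj₂ (proj₂ (hit j)))))
        where
        hit : ∀ j → ∃ (Hit v j)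
        hit j with any? (Hit? v j)
        ... | yes h = h
        ... | no ¬h = contradiction (j , ¬h) ¬found

        hitter : Fin N → V
        hitter j = proj₁ (hit j)

        hitter-inj : Injective _≡_ _≡_ hitter
        hitter-inj {j} {k} e =
          HasIndex-unique (proj₂ (proj₂ (proj₂ (hit j))))
                          (subst (HasIndex k ∘ col) (sym e) (proj₂ (proj₂ (proj₂ (hit k)))))

        target : ∀ {j} → (h : ∃ (Hit v j)) →
                 (R (proj₁ h) × ∃ λ a → col₀ (proj₁ h) ≡ inj₁ a) ⊎ (S (proj₁ h) × p v < p (proj₁ h))
        target (w , inj₁ r , _ , _ , _ , e) =
          inj₁ (r , _ , trans (sym (old λ (s , _) → disjoint s r)) e)
        target (w , inj₂ sw , _) = inj₂ sw

      col′ : V → M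
      col′ v with S? v ×-dec (p v ≟ℕ i)
      ... | yes (s , e) = inj₁ (β v , g v , proj₁ (fresh s e))
      ... | no  _ = col v

      unchanged : ∀ {v} → ¬ (S v × p v ≡ i) → col′ v ≡ col v
      unchanged {v} ¬now with S? v ×-dec (p v ≟ℕ i)
      ... | yes now = contradiction now ¬now
      ... | no _ = refl

      old′ : ∀ {v} → ¬ (S v × i ≤ p v) → col′ v ≡ col₀ v
      old′ ¬new = trans (unchanged λ (s , e) → ¬new (s , ≤-reflexive (sym e)))
                        (old λ (s , i<p) → ¬new (s , <⇒≤ i<p))

      new′ : ∀ {v} → S v → i ≤ p v → ∃ λ j → col′ v ≡ inj₁ (β v , g v , j)
      new′ {v} s i≤p with S? v ×-dec (p v ≟ℕ i)
      ... | yes _ = _ , refl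
      ... | no ¬e = new s (≤∧≢⇒< i≤p λ e → ¬e (s , sym e))

      later-unchanged : ∀ {v w} → i ≤ p v → Later v w → col′ w ≡ col w
      later-unchanged i≤p (inj₁ r) = unchanged λ (s , _) → disjoint s r
      later-unchanged i≤p (inj₂ (_ , pv<pw)) = unchanged λ (_ , e) → <⇒≢ (≤-<-trans i≤p pv<pw) (sym e)

      avoid′ : ∀ {v w j} → S v → i ≤ p v → Later v w → arc (l (β v)) v w →
               HasIndex j (col′ v) → ¬ HasIndex j (col′ w)
      avoid′ {v} {w} s i≤p later a jv jw rewrite later-unchanged i≤p later with S? v ×-dec (p v ≟ℕ i)
      ... | no ¬e = avoid s (≤∧≢⇒< i≤p λ e → ¬e (s , sym e)) later a jv jw
      avoid′ {v} {w} s i≤p later a (_ , _ , refl) jw | yes (s′ , e) =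
        proj₂ (fresh s′ e) (w , later , a , jw)

    stage₀ : Stage 0
    stage₀ = descend K record
      { col = col₀ ; old = λ _ → refl
      ; new = λ s K≤p → contradiction K≤p (<⇒≱ (p<K s))
      ; avoid = λ s K≤p → contradiction K≤p (<⇒≱ (p<K s)) }
      where
      descend : ∀ i → Stage i → Stage 0
      descend zero st = st
      descend (suc i) st = descend i (step st)

    open Stage stage₀ using (col)

    col-old : ∀ {v} → ¬ S v → col v ≡ col₀ v
    col-old ¬s = Stage.old stage₀ (¬s ∘ proj₁)

    col-new : ∀ {v} → S v → ∃ λ j → col v ≡ inj₁ (β v , g v , j)
    col-new s = Stage.new stage₀ s z≤n

    avoid : ∀ {u v b a j} → S u → Later u v → arc (l (β u)) u v →
            col u ≡ inj₁ (b , a , j) → col v ≢ inj₁ (b , a , j)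
    avoid su later a eu ev = Stage.avoid stage₀ su z≤n later a (_ , _ , eu) (_ , _ , ev)

    -- `R` is placed at rank `K`, above all of `S`, because it counts as later than every vertex of
    -- `S`.
    rank : V → ℕ
    rank v with S? v
    ... | yes _ = p v
    ... | no  _ = K

    rank≤K : ∀ v → rank v ≤ K
    rank≤K v with S? v
    ... | yes s = <⇒≤ (p<K s)
    ... | no  _ = ≤-refl

    rank-S : ∀ {v} → S v → rank v ≡ p v
    rank-S {v} s with S? v
    ... | yes _ = refl
    ... | no ¬s = contradiction s ¬s

    rank-R : ∀ {v} → R v → rank v ≡ K
    rank-R {v} r with S? v
    ... | yes s = contradiction r (disjoint s)
    ... | no _ = refl

    col-acyclic : Acyclic (Mono (S ∪ R) col)
    col-acyclic = Acyclic-fibres col (λ (_ , _ , e , _) → e) fibre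
      where
      Class : M → V → V → Set
      Class m u v = Mono (S ∪ R) col u v × col u ≡ m × col v ≡ m

      β-class : ∀ {v b a j} → S v → col v ≡ inj₁ (b , a , j) → β v ≡ b
      β-class s e = cong proj₁ (inj₁-injective (trans (sym (proj₂ (col-new s))) e))

      -- A rise in rank would make `v` a later neighbour of `u` with the same index, which `avoid`
      -- forbids.
      monotone : ∀ {u v b a j} → (S ∪ R) u → (S ∪ R) v → arc (l b) u v →
                 col u ≡ inj₁ (b , a , j) → col v ≡ inj₁ (b , a , j) → rank v ≤ rank u
      monotone {u} {v} (inj₂ r) _ _ _ _ = ≤-trans (rank≤K v) (≤-reflexive (sym (rank-R r)))
      monotone (inj₁ s) (inj₂ r) a eu ev =
        contradiction ev (avoid s (inj₁ r) (subst (λ b → arc (l b) _ _) (sym (β-class s eu)) a) eu)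
      monotone {u} {v} (inj₁ su) (inj₁ sv) a eu ev rewrite rank-S su | rank-S sv =
        ≮⇒≥ λ pu<pv →
          avoid su (inj₂ (sv , pu<pv)) (subst (λ b → arc (l b) _ _) (sym (β-class su eu)) a) eu ev

      on-level : ∀ m i → Acyclic (λ u v → Class m u v × rank u ≡ i × rank v ≡ i)
      -- Rank `K` belongs to `R`, where `col` is still `col₀`; a lower rank is a level of `p` in
      -- `S`, where `g` is acyclic.
      on-level m i with i ≟ℕ K
      ... | yes refl = Acyclic-⊆ (λ (((u , v , e , a) , _) , ru , rv) →
              let u∈R = in-R u ru ; v∈R = in-R v rv
              in u∈R , v∈R , trans (sym (col-old λ s → disjoint s u∈R)) (trans e (col-old λ s → disjoint s v∈R)) , a)
            col₀-acyclic
        where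
        in-R : ∀ {v} → (S ∪ R) v → rank v ≡ K → R v
        in-R (inj₂ r) _ = r
        in-R (inj₁ s) e = contradiction (trans (sym (rank-S s)) e) (<⇒≢ (p<K s))
      ... | no i≢K = Acyclic-⊆ (λ (((u , v , e , a) , _) , ru , rv) →
              let u∈S = in-S u ru ; v∈S = in-S v rv
              in (u∈S , trans (sym (rank-S u∈S)) ru) , (v∈S , trans (sym (rank-S v∈S)) rv) ,
                 cong (proj₁ ∘ proj₂)
                   (inj₁-injective (trans (sym (proj₂ (col-new u∈S))) (trans e (proj₂ (col-new v∈S))))) ,
                 a)
            (g-acyclic i)
        where
        in-S : ∀ {v} → (S ∪ R) v → rank v ≡ i → S v
        in-S (inj₁ s) _ = s
        in-S (inj₂ r) e = contradiction (trans (sym e) (rank-R r)) i≢K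

      fibre : ∀ m → Acyclic (Class m)
      -- Vertices of `S` always receive `inj₁`, so this class lies in `R`.
      fibre (inj₂ x) = Acyclic-⊆ (λ ((u , v , e , a) , eu , ev) →
          let u∈R = in-R u eu ; v∈R = in-R v ev
          in u∈R , v∈R , trans (sym (col-old λ s → disjoint s u∈R)) (trans e (col-old λ s → disjoint s v∈R)) , a)
        col₀-acyclic
        where
        in-R : ∀ {v} → (S ∪ R) v → col v ≡ inj₂ x → R v
        in-R (inj₂ r) _ = r
        in-R (inj₁ s) e with trans (sym (proj₂ (col-new s))) e
        ... | ()
      -- `monotone` follows direction `l b`: along arcs the rank never rises if `l b` is `true`, and
      -- never falls otherwise.
      fibre (inj₁ (b , x , j)) with l b in lb
      ... | true = Acyclic-levels rank
            (λ ((u , v , _ , a) , eu , ev) → monotone u v (subst (λ d → arc d _ _) (sym lb) a) eu ev)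
            (on-level _)
      ... | false = Acyclic-levels⁻ rank K rank≤K
            (λ ((u , v , _ , a) , eu , ev) → monotone v u (subst (λ d → arc d _ _) (sym lb) a) ev eu)
            (on-level _)

    extension : Extension S R col₀
    extension = record
      { col = col ; old = col-old ; acyclic = col-acyclic }

-- Colouring along a geodesic.

module Decomposition {n : ℕ} (D : Digraph n) (l : Bool → Bool) (N : ℕ)
  (e : Bool → Bool) {A : Set} (gN : Fin n → Fin n → A) where
  open Colouring D
  open Greedy D l N

  -- In `few`, `c` and `x` stand for `v₁` and `v₂` of a broom. They will be consecutive path
  -- vertices, or a path vertex and a mixed one.
  module Along {X : Pred V 0ℓ} (X? : Decidable X)
    (gN-acyclic : ∀ {x} → X x → Acyclic (Mono (λ v → X v × Adj x v) (gN x)))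
    (few : ∀ {b c x v} → arc (e b) c x → arc b x v → ¬ Adj c v → c ≢ v →
           Good b v (λ w → X w × ¬ Adj c w × ¬ Adj x w))
    {Z R : Pred V 0ℓ} (R? : Decidable R) (R⊆X : R ⊆ X)
    (Z∩R : ∀ {v} → Z v → ¬ R v) (Z-far : ∀ {z v} → Z z → R v → ¬ Adj z v)
    (γ : Geodesic X Z) where
    open Geodesic γ

    x : ℕ → V
    x = seq true

    Nb : Bool → Pred V 0ℓ
    Nb b v = ∃ λ i → i < 2 + k × arc b (x i) v

    Nb? : ∀ b → Decidable (Nb b)
    Nb? b v = anyUpTo? (λ i → arc? b (x i) v) (2 + k)

    Near : Pred V 0ℓ
    Near v = Nb true v ⊎ Nb false v

    Near? : Decidable Near
    Near? v = Nb? true v ⊎-dec Nb? false v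

    near : ∀ b {v} → Nb b v → Near v
    near true  = inj₁
    near false = inj₂

    reindex : ∀ a a′ {j} → j < 2 + k → ∃ λ i → i < 2 + k × seq a j ≡ seq a′ i
    reindex true  true  {j} j< = j , j< , refl
    reindex false false {j} j< = j , j< , refl
    reindex true  false {j} j< =
      suc k ∸ j , s≤s (m∸n≤m (suc k) j) , flip true (m+[n∸m]≡n (≤-pred j<))
    reindex false true  {j} j< =
      suc k ∸ j , s≤s (m∸n≤m (suc k) j) , flip false (m+[n∸m]≡n (≤-pred j<))

    ¬near-far : ∀ {w} → ¬ Near w → ∀ a {j} → j < 2 + k → ¬ Adj (seq a j) w
    ¬near-far ¬near a j< (b , arc-w) =
      let (i , i< , eq) = reindex a true j<
      in ¬near (near b (i , i< , subst (λ u → arc b u _) eq arc-w))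

    last∈Z : Z (x (suc k))
    last∈Z = subst Z (sym (flip true (+-identityʳ (suc k)))) (end false)

    interior : ∀ {b i v} → R v → i < 2 + k → arc b (x i) v → i ≤ k
    interior r i< a with m≤n⇒m<n∨m≡n (≤-pred i<)
    ... | inj₁ i≤k = ≤-pred i≤k
    ... | inj₂ refl = contradiction (_ , a) (Z-far last∈Z r)

    -- The path is scanned in direction `e b`, so that the first vertex attached to `v` and its
    -- predecessor are joined like `v₂` and `v₁` of broom `b`. The value `2 + k` means that there is
    -- no attachment.
    first : Bool → V → ℕ
    first b v = μ (λ j → arc? b (seq (e b) j) v) (2 + k)

    -- Index 0 is impossible because both ends of the path lie in `Z`, far from `R`; so the first
    -- attachment has a predecessor.
    entry : ∀ b {v} → R v → Nb b v →
            ∃ λ j → first b v ≡ suc j × j ≤ k × arc b (seq (e b) (suc j)) v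
    entry b {v} r (i , i< , a) with first b v in eq | reindex true (e b) i<
    ... | f | (j , j< , refl′) =
      go f eq (≤-<-trans (subst (_≤ j) eq (μ-least Q? (2 + k) at-j)) j<)
         (subst (λ f → arc b (seq (e b) f) v) eq (μ-hit Q? (2 + k) j< at-j))
      where
      Q? : Decidable (λ j → arc b (seq (e b) j) v)
      Q? j = arc? b (seq (e b) j) v
      at-j : arc b (seq (e b) j) v
      at-j = subst (λ u → arc b u v) refl′ a
      go : ∀ f → first b v ≡ f → f < 2 + k → arc b (seq (e b) f) v →
           ∃ λ j → f ≡ suc j × j ≤ k × arc b (seq (e b) (suc j)) v
      go zero _ _ a = contradiction (b , a) (Z-far (end (e b)) r)
      go (suc j) _ f< a = j , refl , ≤-pred (≤-pred f<) , a

    before-first : ∀ b {j v} → j < first b v → ¬ arc b (seq (e b) j) v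
    before-first b {v = v} = μ-minimal (λ j → arc? b (seq (e b) j) v) (2 + k)

    -- Attachments within one layer of the search.

    Rest : ℕ → Pred V 0ℓ
    Rest δ v = (R v × d v ≡ δ) ×
      ¬ (Adj (x (pred δ)) v ⊎ Adj (x δ) v ⊎ Adj (x (suc δ)) v)

    -- By `d-step`, `δ` is at most `i + 1`; the excluded neighbourhoods rule out `δ - 1`, `δ` and
    -- `δ + 1` as values of `i`.
    rest-in : ∀ {δ i v} → Rest δ v → i < 2 + k → arc true (x i) v → suc δ < i
    rest-in {i = i} {v} ((r , refl) , ¬w) i< a
      with m≤n⇒m<n∨m≡n (subst (λ m → d v ≤ suc m) (d-seq (interior {true} r i< a)) (d-step (seq∈X true i) (R⊆X r) a))
    ... | inj₂ eq = contradiction (inj₁ (true , subst (λ m → Arc D (x m) _) (sym (cong pred eq)) a)) ¬w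
    ... | inj₁ (s≤s δ≤i) with m≤n⇒m<n∨m≡n δ≤i
    ... | inj₂ eq = contradiction (inj₂ (inj₁ (true , subst (λ m → Arc D (x m) _) (sym eq) a))) ¬w
    ... | inj₁ δ<i with m≤n⇒m<n∨m≡n δ<i
    ... | inj₂ eq = contradiction (inj₂ (inj₂ (true , subst (λ m → Arc D (x m) _) (sym eq) a))) ¬w
    ... | inj₁ 1+δ<i = 1+δ<i

    rest-out : ∀ {δ i v} → Rest δ v → i < 2 + k → arc false (x i) v → suc i < δ
    rest-out {i = i} {v} ((r , refl) , ¬w) i< a
      with m≤n⇒m<n∨m≡n (subst (_≤ suc (d v)) (d-seq (interior {false} r i< a)) (d-step (R⊆X r) (seq∈X true i) a))
    ... | inj₂ refl = contradiction (inj₂ (inj₂ (false , a))) ¬w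
    ... | inj₁ (s≤s i≤δ) with m≤n⇒m<n∨m≡n i≤δ
    ... | inj₂ refl = contradiction (inj₂ (inj₁ (false , a))) ¬w
    ... | inj₁ i<δ with m≤n⇒m<n∨m≡n i<δ
    ... | inj₂ eq = contradiction (inj₁ (false , subst (λ m → arc false (x m) _) (cong pred eq) a)) ¬w
    ... | inj₁ 1+i<δ = 1+i<δ

    -- In a fixed layer, in-neighbours on the path come well after index δ and
    -- out-neighbours well before it.
    separated : ∀ b {δ i i′ v w} → Rest δ v → Rest δ w → i < 2 + k → i′ < 2 + k →
                i ≤ suc i′ → i′ ≤ suc i → arc b (x i) v → ¬ arc (not b) (x i′) w
    separated true rv rw i< i′< i≤ i′≤ a a′ =
      <-irrefl refl (<-trans (<-≤-trans (rest-in rv i< a) i≤) (m<n⇒m<1+n (rest-out rw i′< a′)))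
    separated false rv rw i< i′< i≤ i′≤ a a′ =
      <-irrefl refl (<-trans (<-≤-trans (rest-in rw i′< a′) i′≤) (m<n⇒m<1+n (rest-out rv i< a)))

    edge : ∀ a {j} → j ≤ k → ∃ λ i → ∃ λ i′ → i < 2 + k × i′ < 2 + k × i ≤ suc i′ × i′ ≤ suc i ×
           seq a (suc j) ≡ x i × seq a j ≡ x i′
    edge true {j} j≤k =
      suc j , j , s≤s (s≤s j≤k) , s≤s (m≤n⇒m≤1+n j≤k) , ≤-refl , m≤n⇒m≤1+n (n≤1+n j) , refl , refl
    edge false {j} j≤k =
      k ∸ j , suc (k ∸ j) , s≤s (m≤n⇒m≤1+n (m∸n≤m k j)) , s≤s (s≤s (m∸n≤m k j)) ,
      m≤n⇒m≤1+n (n≤1+n _) , ≤-refl , flip false (cong suc (m+[n∸m]≡n j≤k)) ,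
      flip false (trans (+-suc j (k ∸ j)) (cong suc (m+[n∸m]≡n j≤k)))

    module _ (δ : ℕ) (b : Bool) where

      private
        y : ℕ → V
        y = seq (e b)

      Side : Pred V 0ℓ
      Side v = Rest δ v × Nb b v

      Side? : Decidable Side
      Side? v = ((R? v ×-dec (d v ≟ℕ δ)) ×-dec
                 ¬? (Adj? (x (pred δ)) v ⊎-dec (Adj? (x δ) v ⊎-dec Adj? (x (suc δ)) v)))
                ×-dec Nb? b v

      -- Were `y j` equal to `v`, its forward index would be `δ` by `d-seq`, and `y (suc j)` would
      -- see `v` from a closer index than `rest-in` or `rest-out` allows. The last path vertex is
      -- covered by `Z∩R` instead.
      not-on-path : ∀ {j v} → Rest δ v → j ≤ k → arc b (y (suc j)) v → y j ≢ v
      not-on-path {j} {v} rest@((r , dv) , _) j≤k a yj≡v with edge (e b) j≤k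
      ... | i , i′ , i< , i′< , i≤ , i′≤ , eq , eq′ with m≤n⇒m<n∨m≡n (≤-pred i′<)
      ... | inj₂ refl = Z∩R (subst Z (trans (sym eq′) yj≡v) last∈Z) r
      ... | inj₁ i′<1+k = go b (subst (λ u → arc b u v) eq a)
        where
        i′≡δ : i′ ≡ δ
        i′≡δ = trans (sym (d-seq (≤-pred i′<1+k))) (trans (cong d (trans (sym eq′) yj≡v)) dv)
        go : ∀ b → arc b (x i) v → ⊥
        go true  a = <-irrefl (cong suc (sym i′≡δ)) (<-≤-trans (rest-in rest i< a) i≤)
        go false a = <-irrefl i′≡δ (≤-<-trans i′≤ (rest-out rest i< a))

      -- `few` is applied to `y j` and `y (suc j)`, the latter being the first attachment of `v`.
      -- Vertices attached later miss both in direction `b` by minimality, and in the other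
      -- direction by `separated`.
      side-good : ∀ {v} → Side v → Good b v (λ w → Side w × first b v < first b w)
      side-good {v} (rest@((r , _) , _) , nb) with entry b r nb
      ... | j , fv , j≤k , a = Good-⊆ later
              (few (step (e b) j≤k) a (¬Adj b (before-first b j<fv) (other rest)) (not-on-path rest j≤k a))
        where
        j<fv : j < first b v
        j<fv = ≤-reflexive (sym fv)

        other : ∀ {w} → Rest δ w → ¬ arc (not b) (y j) w
        other rw a′ with edge (e b) j≤k
        ... | i , i′ , i< , i′< , i≤ , i′≤ , eq , eq′ =
          separated b rest rw i< i′< i≤ i′≤ (subst (λ u → arc b u v) eq a)
            (subst (λ u → arc (not b) u _) eq′ a′)

        other′ : ∀ {w} → Rest δ w → ¬ arc (not b) (y (suc j)) w
        other′ rw a′ with edge (e b) j≤k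
        ... | i , _ , i< , _ , _ , _ , eq , _ =
          separated b rest rw i< i< (n≤1+n i) (n≤1+n i) (subst (λ u → arc b u v) eq a)
            (subst (λ u → arc (not b) u _) eq a′)

        later : ∀ {w} → Side w × first b v < first b w → X w × ¬ Adj (y j) w × ¬ Adj (y (suc j)) w
        later ((rw@((w∈R , _) , _) , _) , fv<fw) =
          R⊆X w∈R ,
          ¬Adj b (before-first b (<-trans j<fv fv<fw)) (other rw) ,
          ¬Adj b (before-first b (subst (_< _) fv fv<fw)) (other′ rw)

      -- Vertices with the same first attachment share a neighbourhood, which `gN` colours; nothing
      -- is coloured beforehand, so `Extend` runs over an empty `R`.
      side-col : Col Side (Palette A N ⊎ ⊤)
      side-col = E.col , Acyclic-⊆ (Mono-⊆ inj₁) E.acyclic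
        where
        level : ∀ i → Acyclic (Mono (λ v → Side v × first b v ≡ i) (λ v → gN (y (first b v)) v))
        level i = Acyclic-⊆
          (λ { {u} {v} ((su , refl) , (sv , ev) , eq , a) →
               side-adj su , subst (λ i → X v × Adj (y i) v) ev (side-adj sv) ,
               trans eq (cong (λ i → gN (y i) v) ev) , a })
          (gN-acyclic (seq∈X (e b) i))
          where
          side-adj : ∀ {v} → Side v → X v × Adj (y (first b v)) v
          side-adj (((r , _) , _) , nb) with entry b r nb
          ... | j , fv , _ , a = R⊆X r , b , subst (λ i → arc b (y i) _) (sym fv) a

        uncoloured : V → Palette A N ⊎ ⊤
        uncoloured _ = inj₂ tt

        ∅-acyclic : Acyclic (Mono ∅ uncoloured)
        ∅-acyclic _ [ () , _ ]
        ∅-acyclic _ ((() , _) ∷ _)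

        good : ∀ {v} → Side v → ∃ λ b′ → Good b′ v
          (λ w → (∅ w × ∃ λ a → uncoloured w ≡ inj₁ a) ⊎ (Side w × first b v < first b w))
        good s = b , Good-⊆ (λ { (inj₂ later) → later }) (side-good s)

        first<3+k : ∀ {v} → Side v → first b v < 3 + k
        first<3+k _ = s≤s (μ≤ _ (2 + k))

        ∅? : Decidable ∅
        ∅? _ = no λ ()

        ext : Extension Side ∅ uncoloured
        ext = Extend.extension D l N Side? ∅? (λ _ ()) (first b) (3 + k) first<3+k
          (λ v → gN (y (first b v)) v) level uncoloured ∅-acyclic good
        module E = Extension ext

    On : Pred V 0ℓ
    On v = R v × Near v

    on-col : Col On (PathColour A N)
    on-col = Col-layers d (λ (r , _) (r′ , _) → d-step (R⊆X r) (R⊆X r′)) λ δ →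
      Col-⊆ (classify δ)
        (Col-∪ (On-x? _) (nbhd _) (Col-∪ (On-x? _) (nbhd _) (Col-∪ (On-x? _) (nbhd _)
          (Col-∪ (Side? δ true) (side-col δ true) (side-col δ false)))))
      where
      On-x : ℕ → Pred V 0ℓ
      On-x i v = X v × Adj (x i) v

      On-x? : ∀ i → Decidable (On-x i)
      On-x? i v = X? v ×-dec Adj? (x i) v

      nbhd : ∀ i → Col (On-x i) A
      nbhd i = gN (x i) , gN-acyclic (seq∈X true i)

      classify : ∀ δ → (λ v → On v × d v ≡ δ) ⊆
                 On-x (pred δ) ∪ On-x δ ∪ On-x (suc δ) ∪ Side δ true ∪ Side δ false
      classify δ {v} ((r , nr) , dv)
        with Adj? (x (pred δ)) v | Adj? (x δ) v | Adj? (x (suc δ)) v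
      ... | yes a | _ | _ = inj₁ (R⊆X r , a)
      ... | no _ | yes a | _ = inj₂ (inj₁ (R⊆X r , a))
      ... | no _ | no _ | yes a = inj₂ (inj₂ (inj₁ (R⊆X r , a)))
      ... | no ¬a | no ¬b | no ¬c = inj₂ (inj₂ (inj₂ (side nr)))
        where
        rest : Rest δ v
        rest = (r , dv) , either ¬a (either ¬b ¬c)
        side : Near v → (Side δ true ∪ Side δ false) v
        side (inj₁ nb) = inj₁ (rest , nb)
        side (inj₂ nb) = inj₂ (rest , nb)

    -- Absorbing the neighbourhood of the path.

    -- With no arc in the other direction, the predecessor of the first attachment is nonadjacent to
    -- `v`. It also differs from `v`, which would otherwise lie in `Z` or have a still earlier
    -- neighbour on the path.
    pure-good : ∀ {v} b → R v → Nb b v → ¬ Nb (not b) v → Good b v (λ w → X w × ¬ Near w)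
    pure-good {v} b r nb ¬nb with entry b r nb
    ... | j , fv , j≤k , a =
      Good-⊆ (λ (xw , ¬nw) → xw , ¬near-far ¬nw (e b) j< , ¬near-far ¬nw (e b) (s≤s (s≤s j≤k)))
        (few (step (e b) j≤k) a ¬adj (λ eq → off j (≤-reflexive (sym fv)) j≤k eq))
      where
      j< : j < 2 + k
      j< = s≤s (m≤n⇒m≤1+n j≤k)

      not-adj : ∀ {i} → i < first b v → i < 2 + k → ¬ Adj (seq (e b) i) v
      not-adj i<f i< = ¬Adj b (before-first b i<f) λ a′ →
        let (i′ , i′< , eq) = reindex (e b) true i<
        in ¬nb (i′ , i′< , subst (λ u → arc (not b) u v) eq a′)

      ¬adj : ¬ Adj (seq (e b) j) v
      ¬adj = not-adj (≤-reflexive (sym fv)) j<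

      off : ∀ j → j < first b v → j ≤ k → seq (e b) j ≢ v
      off zero _ _ eq = Z∩R (subst Z eq (end (e b))) r
      off (suc j) j<f j≤k eq =
        not-adj (<-trans (n<1+n j) j<f) (s≤s (m≤n⇒m≤1+n (<⇒≤ j≤k)))
                (e b , subst (arc (e b) _) eq (step (e b) (<⇒≤ j≤k)))

    on-path-near : ∀ {i v} → R v → i < 2 + k → x i ≡ v → Near v
    on-path-near {zero} r _ refl = contradiction r (Z∩R (end true))
    on-path-near {suc i} r (s≤s (s≤s i≤k)) refl = inj₁ (i , s≤s (m≤n⇒m≤1+n i≤k) , step true i≤k)

    Mixed : Pred V 0ℓ
    Mixed v = R v × Nb true v × Nb false v

    Mixed? : Decidable Mixed
    Mixed? v = R? v ×-dec (Nb? true v ×-dec Nb? false v)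

    -- The path sees `m` in both directions, so whichever broom the arc between `m` and `u` calls
    -- for, some path vertex plays `v₁` with `m` as `v₂`.
    mixed-good : ∀ {m u} → Mixed m → R u → ¬ Near u → Adj m u →
                 ∃ λ b → Good b u (λ w → X w × ¬ Near w × ¬ Adj m w)
    mixed-good {m} {u} (_ , nb) r ¬nu (b , a) with pick (e b) nb
      where
      pick : ∀ a → Nb true m × Nb false m → Nb a m
      pick true  = proj₁
      pick false = proj₂
    ... | i , i< , c = b , Good-⊆ (λ (xw , ¬nw , ¬mw) → xw , ¬near-far ¬nw true i< , ¬mw)
      (few c a (¬near-far ¬nu true i<) (λ eq → ¬nu (on-path-near r i< eq)))

    Remaining : Pred V 0ℓ
    Remaining v = R v × ¬ Near v × ¬ ∃ λ m → Mixed m × Adj m v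

    Remaining? : Decidable Remaining
    Remaining? v = R? v ×-dec (¬? (Near? v) ×-dec ¬? (any? λ m → Mixed? m ×-dec Adj? m v))

    -- `x 1` is outside `Z`, and outside `R` because it is adjacent to `x 0`; so it has a neighbour
    -- in `R`. Thus every round removes a vertex from `R`.
    near-exists : (∀ {v} → X v → ¬ Z v → ¬ R v → ∃ λ r → R r × Adj v r) → ∃ λ r → R r × Near r
    near-exists touches =
      let (r , r∈R , b , a) = touches (seq∈X true 1) leave x₁∉R
      in r , r∈R , near b (1 , s≤s (s≤s z≤n) , a)
      where
      x₁∉R : ¬ R (x 1)
      x₁∉R r = Z-far (end true) r (true , step true z≤n)

    -- `B` holds both the colours of `On` and, through `ι`, the neighbourhood colours given by `gN`.
    module Absorb {B : Set} (ι : A → B) (ι-inj : Injective _≡_ _≡_ ι) (on-col : Col On B) where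
      Colour : Set
      Colour = Palette B N ⊎ B

      -- Mixed vertices receive private colours, which is harmless because they have no neighbour
      -- among the remaining vertices. All others are coloured greedily.
      extend : Col Remaining Colour → Col R Colour
      extend (col₀ , col₀-acyclic) = Col-⊆ cover (E₂.col , E₂.acyclic)
        where
        Base : Pred V 0ℓ
        Base = Remaining ∪ Mixed

        base : Col Base Colour
        base = Col-split Mixed? no-arc
          (Col-⊆ mixed-on (Col-map inj₂ inj₂-injective on-col))
          (Col-⊆ remaining (col₀ , col₀-acyclic))
          where
          mixed-on : Base ∩ Mixed ⊆ On
          mixed-on (_ , r , nb , _) = r , inj₁ nb
          remaining : (λ v → Base v × ¬ Mixed v) ⊆ Remaining
          remaining (inj₁ r , _) = r
          remaining (inj₂ m , ¬m) = contradiction m ¬m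
          no-arc : ∀ {u v} → (Base ∩ Mixed) u → Base v → ¬ Mixed v → ¬ Arc D u v
          no-arc (_ , m) (inj₁ (_ , _ , ¬adj)) _ a = ¬adj (_ , m , true , a)
          no-arc _ (inj₂ m) ¬m _ = ¬m m

        base-mixed : ∀ {v a} → Mixed v → proj₁ base v ≢ inj₁ a
        base-mixed {v} m e with Mixed? v
        base-mixed m () | yes _
        ... | no ¬m = ¬m m

        U : Pred V 0ℓ
        U v = R v × ¬ Near v × ∃ λ m → Mixed m × Adj m v

        mixedNb? : ∀ v → Decidable (λ m → Mixed m × Adj m v)
        mixedNb? v m = Mixed? m ×-dec Adj? m v

        U? : Decidable U
        U? v = R? v ×-dec (¬? (Near? v) ×-dec any? (mixedNb? v))

        -- The least mixed neighbour is taken so that vertices later in the order are nonadjacent to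
        -- it, as `mixed-good` requires. Without a mixed neighbour, `v` is a dummy value.
        mixedNb : V → V
        mixedNb v with any? (mixedNb? v)
        ... | yes found = proj₁ (least (mixedNb? v) found)
        ... | no  _ = v

        mixedNb-spec : ∀ {v} → U v → (Mixed (mixedNb v) × Adj (mixedNb v) v) ×
                 (∀ {i} → toℕ i < toℕ (mixedNb v) → ¬ (Mixed i × Adj i v))
        mixedNb-spec {v} (_ , _ , found) with any? (mixedNb? v)
        ... | yes found′ = proj₂ (least (mixedNb? v) found′)
        ... | no ¬found  = contradiction found ¬found

        g : V → B
        g v = ι (gN (mixedNb v) v)

        g-acyclic : ∀ i → Acyclic (Mono (λ v → U v × toℕ (mixedNb v) ≡ i) g)
        -- A level is only a number, while `gN-acyclic` needs a vertex of `X`; that vertex is read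
        -- off the loop.
        g-acyclic i v loop = Acyclic-fibres mixedNb (λ ((_ , eu) , (_ , ev) , _) → toℕ-injective (trans eu (sym ev)))
          (λ c v loop → gN-acyclic (c∈X loop) v (mapTC
            (λ { {u} {v} (((u∈U , _) , (v∈U , _) , eq , a) , refl , ev) →
                 (R⊆X (proj₁ u∈U) , proj₂ (proj₁ (mixedNb-spec u∈U))) ,
                 (R⊆X (proj₁ v∈U) , subst (λ c → Adj c v) ev (proj₂ (proj₁ (mixedNb-spec v∈U)))) ,
                 trans (ι-inj eq) (cong (λ c → gN c v) ev) , a }) loop))
          v loop
          where
          source : ∀ {c u} → U u → mixedNb u ≡ c → X c
          source u∈U refl = R⊆X (proj₁ (proj₁ (proj₁ (mixedNb-spec u∈U))))
          c∈X : ∀ {c u v} → TransClosure (λ u v → Mono (λ v → U v × toℕ (mixedNb v) ≡ i) g u v × mixedNb u ≡ c × mixedNb v ≡ c) u v → X c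
          c∈X [ ((u∈U , _) , _) , eu , _ ] = source u∈U eu
          c∈X ((((u∈U , _) , _) , eu , _) ∷ _) = source u∈U eu

        Base? : Decidable Base
        Base? v = Remaining? v ⊎-dec Mixed? v

        U-disjoint : ∀ {v} → U v → ¬ Base v
        U-disjoint (_ , ¬nr , _) (inj₂ (_ , nb , _)) = ¬nr (inj₁ nb)
        U-disjoint (_ , _ , found) (inj₁ (_ , _ , ¬found)) = ¬found found

        -- Remaining vertices have no mixed neighbour, mixed ones carry no greedy colour, and later
        -- vertices of `U` miss `mixedNb u` by minimality.
        U-good : ∀ {u} → U u → ∃ λ b → Good b u
          (λ w → (Base w × ∃ λ a → proj₁ base w ≡ inj₁ a) ⊎ (U w × toℕ (mixedNb u) < toℕ (mixedNb w)))
        U-good u∈U@(r , ¬nr , _) =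
          let ((mixed , adj) , _) = mixedNb-spec u∈U
              (b , good) = mixed-good mixed r ¬nr adj
          in b , Good-⊆ (λ
          { (inj₁ (inj₁ (r , ¬nr , ¬adj) , _)) → R⊆X r , ¬nr , λ a → ¬adj (_ , mixed , a)
          ; (inj₁ (inj₂ m , _ , e)) → contradiction e (base-mixed m)
          ; (inj₂ (w∈U , mu<mw)) → R⊆X (proj₁ w∈U) , proj₁ (proj₂ w∈U) ,
                                   λ a → proj₂ (mixedNb-spec w∈U) mu<mw (mixed , a) }) good

        ext₁ : Extension U Base (proj₁ base)
        ext₁ = Extend.extension D l N U? Base? U-disjoint (toℕ ∘ mixedNb) n (λ _ → toℕ<n _)
          g g-acyclic (proj₁ base) (proj₂ base) U-good
        module E₁ = Extension ext₁

        Pure : Pred V 0ℓ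
        Pure v = On v × ¬ Mixed v

        pure : ∀ {v} → Pure v → ∃ λ b → Good b v (λ w → X w × ¬ Near w)
        pure ((r , inj₁ nb) , ¬m) = true  , pure-good true r nb (λ nb′ → ¬m (r , nb , nb′))
        pure ((r , inj₂ nb) , ¬m) = false , pure-good false r nb (λ nb′ → ¬m (r , nb′ , nb))

        Pure? : Decidable Pure
        Pure? v = (R? v ×-dec Near? v) ×-dec ¬? (Mixed? v)

        U∪Base? : Decidable (U ∪ Base)
        U∪Base? v = U? v ⊎-dec Base? v

        Pure-disjoint : ∀ {v} → Pure v → ¬ (U ∪ Base) v
        Pure-disjoint ((_ , nr) , _) (inj₁ (_ , ¬nr , _)) = ¬nr nr
        Pure-disjoint ((_ , nr) , _) (inj₂ (inj₁ (_ , ¬nr , _))) = ¬nr nr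
        Pure-disjoint (_ , ¬m) (inj₂ (inj₂ m)) = ¬m m

        Pure-good : ∀ {v} → Pure v → ∃ λ b → Good b v
          (λ w → ((U ∪ Base) w × ∃ λ a → E₁.col w ≡ inj₁ a) ⊎ (Pure w × 0 < 0))
        Pure-good v∈Pure = let (b , good) = pure v∈Pure in b , Good-⊆ (λ
          { (inj₁ (inj₁ (r , ¬nr , _) , _)) → R⊆X r , ¬nr
          ; (inj₁ (inj₂ (inj₁ (r , ¬nr , _)) , _)) → R⊆X r , ¬nr
          ; (inj₁ (inj₂ (inj₂ m@(_ , nb , _)) , _ , e)) →
              contradiction (trans (sym (E₁.old λ (_ , ¬nr , _) → ¬nr (inj₁ nb))) e) (base-mixed m)
          ; (inj₂ (_ , ())) }) good

        ext₂ : Extension Pure (U ∪ Base) E₁.col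
        -- One level suffices, as `on-col` is acyclic on all of `On`.
        ext₂ = Extend.extension D l N Pure? U∪Base? Pure-disjoint (λ _ → 0) 1 (λ _ → s≤s z≤n) (proj₁ on-col)
          (λ _ → Acyclic-⊆ (Mono-⊆ (proj₁ ∘ proj₁)) (proj₂ on-col))
          E₁.col E₁.acyclic Pure-good
        module E₂ = Extension ext₂

        cover : R ⊆ Pure ∪ (U ∪ Base)
        cover {v} r with Mixed? v | Near? v | any? (mixedNb? v)
        ... | yes m | _      | _         = inj₂ (inj₂ (inj₂ m))
        ... | no ¬m | yes nr | _         = inj₁ ((r , nr) , ¬m)
        ... | no ¬m | no ¬nr | yes found = inj₂ (inj₁ (r , ¬nr , found))
        ... | no ¬m | no ¬nr | no ¬found = inj₂ (inj₂ (inj₁ (r , ¬nr , ¬found)))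

    absorb : (∀ {v} → X v → ¬ Z v → ¬ R v → ∃ λ r → R r × Adj v r) →
             ∃ λ (R′ : Pred V 0ℓ) → Decidable R′ × R′ ⊆ R × (∃ λ v → R v × ¬ R′ v) ×
               (Col R′ (FarColour A N) → Col R (FarColour A N))
    absorb touches =
      let (v , v∈R , near-v) = near-exists touches
      in Remaining , Remaining? , proj₁ , (v , v∈R , λ (_ , ¬near , _) → ¬near near-v) ,
         Absorb.extend (λ a → true , inj₁ a) (inj₁-injective ∘ cong proj₂) on-col

  -- Exhausting a vertex set and splitting along cuts.

  module Ambient {X : Pred V 0ℓ} (X? : Decidable X)
    (gN-acyclic : ∀ {x} → X x → Acyclic (Mono (λ v → X v × Adj x v) (gN x)))
    (few : ∀ {b c x v} → arc (e b) c x → arc b x v → ¬ Adj c v → c ≢ v →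
           Good b v (λ w → X w × ¬ Adj c w × ¬ Adj x w))
    where

    -- `c` always belongs to `Z`, so a search can start as long as `R` is nonempty. A geodesic
    -- shrinks `R`; a cut ends the process.
    peel : ∀ {c} → X c → ∀ fuel {R} → Decidable R → R ⊆ X → ¬ R c → (∀ {v} → R v → ¬ Adj c v) →
           R ⊑ fuel → Col R (FarColour A N) ⊎ OneWayCut X
    peel {c} c∈X fuel {R} R? R⊆X c∉R c-far bound with any? R?
    ... | no empty = inj₁ ((λ _ → inj₂ (true , inj₁ (gN c c))) ,
                           λ { _ [ r , _ ] → empty (_ , r) ; _ ((r , _) ∷ _) → empty (_ , r) })
    ... | yes (r , r∈R) = step fuel bound (Search.search D X? Z? (λ (xv , _) → xv)
            (c , c∈X , c∉R , λ (_ , r , a) → c-far r a) (r , R⊆X r∈R , λ (_ , ¬r , _) → ¬r r∈R)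
            n 0 (⊑-full _))
      where
      Z : Pred V 0ℓ
      Z v = X v × ¬ R v × ¬ ∃ λ r → R r × Adj v r

      Z? : Decidable Z
      Z? v = X? v ×-dec (¬? (R? v) ×-dec ¬? (any? λ r → R? r ×-dec Adj? v r))

      step : ∀ fuel → R ⊑ fuel → Geodesic X Z ⊎ OneWayCut X → Col R (FarColour A N) ⊎ OneWayCut X
      step _ _ (inj₂ cut) = inj₂ cut
      step zero bound (inj₁ _) = contradiction r∈R (⊑-zero bound)
      step (suc fuel) bound (inj₁ γ) = next (Along.absorb X? gN-acyclic few R? R⊆X
          (λ (_ , ¬r , _) → ¬r) (λ (_ , _ , ¬adj) r a → ¬adj (_ , r , a)) γ touches)
        where
        next : (∃ λ (R′ : Pred V 0ℓ) → Decidable R′ × R′ ⊆ R × (∃ λ v → R v × ¬ R′ v) ×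
                 (Col R′ (FarColour A N) → Col R (FarColour A N))) → Col R (FarColour A N) ⊎ OneWayCut X
        next (R′ , R′? , R′⊆R , (v , v∈R , v∉R′) , extend) = map₁ extend
          (peel c∈X fuel R′? (R⊆X ∘ R′⊆R) (c∉R ∘ R′⊆R) (c-far ∘ R′⊆R) (⊑-shrink bound v∈R R′⊆R v∉R′))

        touches : ∀ {v} → X v → ¬ Z v → ¬ R v → ∃ λ r → R r × Adj v r
        touches {v} xv ¬z ¬r with any? (λ r → R? r ×-dec Adj? v r)
        ... | yes found = found
        ... | no ¬found = contradiction (xv , ¬r , ¬found) ¬z

    col-or-cut : ∀ {c} → X c → Col X (FullColour A N) ⊎ OneWayCut X
    col-or-cut {c} c∈X = map₁ combine
      (peel c∈X n far? proj₁ (λ (_ , _ , c≢c) → c≢c refl) (λ (_ , ¬adj , _) → ¬adj) (⊑-full _))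
      where
      Far Nbhd : Pred V 0ℓ
      Far v = X v × ¬ Adj c v × v ≢ c
      Nbhd v = X v × Adj c v

      far? : Decidable Far
      far? v = X? v ×-dec (¬? (Adj? c v) ×-dec ¬? (v ≟ c))

      nbhd? : Decidable Nbhd
      nbhd? v = X? v ×-dec Adj? c v

      singleton : Col (_≡ c) ⊤
      singleton = (λ _ → tt) , λ { _ [ refl , refl , _ , a ] → loop a ; _ ((refl , refl , _ , a) ∷ _) → loop a }
        where
        loop : ∀ {v} → ¬ Arc D v v
        loop a with trans (sym a) (loopless D _)
        ... | ()

      combine : Col Far (FarColour A N) → Col X (FullColour A N)
      combine far = Col-⊆ cover (Col-∪ far? far (Col-∪ nbhd? (gN c , gN-acyclic c∈X) singleton))
        where
        cover : X ⊆ Far ∪ Nbhd ∪ (_≡ c)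
        cover {v} xv with Adj? c v | v ≟ c
        ... | yes a | _       = inj₂ (inj₁ (xv , a))
        ... | no ¬a | yes eq  = inj₂ (inj₂ eq)
        ... | no ¬a | no v≢c  = inj₁ (xv , ¬a , v≢c)

  -- Cuts cost no colours: `Col-split` reuses the palette, and the hypotheses on `gN` and `few` pass
  -- to subsets of `X`.
  colour : ∀ fuel {X} → Decidable X →
    (∀ {x} → X x → Acyclic (Mono (λ v → X v × Adj x v) (gN x))) →
    (∀ {b c x v} → arc (e b) c x → arc b x v → ¬ Adj c v → c ≢ v →
      Good b v (λ w → X w × ¬ Adj c w × ¬ Adj x w)) →
    X ⊑ fuel → Col X (FullColour A N)
  colour fuel {X} X? gN-acyclic few bound with any? X?
  ... | no empty = (λ _ → inj₂ (inj₂ tt)) , λ { _ [ x , _ ] → empty (_ , x) ; _ ((x , _) ∷ _) → empty (_ , x) }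
  ... | yes (c , c∈X) = cut-up fuel bound (Ambient.col-or-cut X? gN-acyclic few c∈X)
    where
    cut-up : ∀ fuel → X ⊑ fuel → Col X (FullColour A N) ⊎ OneWayCut X → Col X (FullColour A N)
    cut-up _ _ (inj₁ col) = col
    cut-up zero bound (inj₂ _) = contradiction c∈X (⊑-zero bound)
    cut-up (suc fuel) bound (inj₂ cut) = Col-split Q? no-arc
      (part Q? (⊑-shrink bound (proj₁ (proj₂ outside)) proj₁ λ (_ , q) → proj₂ (proj₂ outside) q))
      (part (λ v → ¬? (Q? v)) (⊑-shrink bound (proj₁ (proj₂ inside)) proj₁ λ (_ , ¬q) → ¬q (proj₂ (proj₂ inside))))
      where
      open OneWayCut cut
      part : ∀ {P} → Decidable P → (X ∩ P) ⊑ fuel → Col (X ∩ P) (FullColour A N)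
      part P? = colour fuel (λ v → X? v ×-dec P? v)
        (λ (xx , _) → Acyclic-⊆ (Mono-⊆ λ ((xv , _) , a) → xv , a) (gN-acyclic xx))
        (λ a a′ ¬adj c≢v → Good-⊆ (λ ((xw , _) , ¬a , ¬a′) → xw , ¬a , ¬a′) (few a a′ ¬adj c≢v))

-- Ramsey bounds for stable sets and transitive tournaments.

AllPairs-lookup : ∀ {A : Set} {R : A → A → Set} {xs} → AllPairs R xs →
                  ∀ i j → toℕ i < toℕ j → R (lookup xs i) (lookup xs j)
AllPairs-lookup (r ∷ _) zero (suc j) _ = All.lookup r (∈-lookup j)
AllPairs-lookup (_ ∷ rs) (suc i) (suc j) (s≤s i<j) = AllPairs-lookup rs i j i<j

module _ {A : Set} {Q : Pred A 0ℓ} (Q? : Decidable Q) where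

  length-filter-complement : ∀ xs → length (filter Q? xs) + length (filter (¬? ∘ Q?) xs) ≡ length xs
  length-filter-complement [] = refl
  length-filter-complement (x ∷ xs) with Q? x
  ... | yes _ = cong suc (length-filter-complement xs)
  ... | no  _ = trans (+-suc _ _) (cong suc (length-filter-complement xs))

  filter-pigeonhole : ∀ a {b} xs → a + b ≤ length xs →
                      a ≤ length (filter Q? xs) ⊎ b ≤ length (filter (¬? ∘ Q?) xs)
  filter-pigeonhole a {b} xs a+b≤ with a ≤? length (filter Q? xs)
  ... | yes a≤ = inj₁ a≤
  ... | no a≰ = inj₂ (+-cancelˡ-≤ a _ _ (≤-trans a+b≤
    (≤-trans (≤-reflexive (sym (length-filter-complement xs))) (+-monoˡ-≤ _ (<⇒≤ (≰⇒> a≰))))))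

  All-filter : ∀ {P : Pred A 0ℓ} {xs} → All P xs → All (P ∩ Q) (filter Q? xs)
  All-filter {xs = xs} ps = All.zip (Allₚ.filter⁺ Q? ps , Allₚ.all-filter Q? xs)

-- One vertex is set aside. Its nonneighbours account for the last summand, its neighbours for the
-- doubled one, as they split further into out- and in-neighbours.
ramsey : ℕ → ℕ → ℕ
ramsey zero t = 0
ramsey (suc r) zero = 0
ramsey (suc r) (suc t) = suc ((ramsey (suc r) t + ramsey (suc r) t) + ramsey r (suc t))

module Structure {n : ℕ} (D : Digraph n) where
  open Colouring D

  Stable : V → V → Set
  Stable u v = u ≢ v × ¬ Adj u v

  Stable-sym : ∀ {u v} → Stable u v → Stable v u
  Stable-sym (u≢v , ¬adj) = ≢-sym u≢v , ¬adj ∘ Adj-sym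

  arc⇒≢ : ∀ b {u v} → arc b u v → u ≢ v
  arc⇒≢ true  a refl = contradiction (trans (sym a) (loopless D _)) λ ()
  arc⇒≢ false a refl = contradiction (trans (sym a) (loopless D _)) λ ()

  -- `AllPairs` relates each entry to all later ones: with `Arc D` the list is a transitive
  -- tournament in its order, with `Stable` an independent set.
  Sublist : Pred V 0ℓ → (V → V → Set) → ℕ → Set
  Sublist P R k = ∃ λ ys → length ys ≡ k × All P ys × AllPairs R ys

  TTFree : ℕ → Pred V 0ℓ → Set
  TTFree t X = ¬ Sublist X (Arc D) t

  stable-or-transitive : ∀ r t {P xs} → AllPairs _≢_ xs → All P xs → ramsey r t ≤ length xs →
                         Sublist P Stable r ⊎ Sublist P (Arc D) t
  stable-or-transitive zero t _ _ _ = inj₁ ([] , refl , [] , [])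
  stable-or-transitive (suc r) zero _ _ _ = inj₂ ([] , refl , [] , [])
  stable-or-transitive (suc r) (suc t) {P} {x ∷ xs} (x≢ ∷ distinct) (px ∷ ps) (s≤s len)
    with filter-pigeonhole (Adj? x) (ramsey (suc r) t + ramsey (suc r) t) xs len
  ... | inj₂ far≥ with stable-or-transitive r (suc t) (AllPairsₚ.filter⁺ (¬? ∘ Adj? x) distinct)
                         (All-filter (¬? ∘ Adj? x) (All.zip (ps , x≢))) far≥
  ... | inj₁ (ys , len , all , stable) =
        inj₁ (x ∷ ys , cong suc len , px ∷ All.map (proj₁ ∘ proj₁) all ,
              All.map (λ ((_ , x≢y) , ¬adj) → x≢y , ¬adj) all ∷ stable)
  ... | inj₂ (ys , len , all , arcs) = inj₂ (ys , len , All.map (proj₁ ∘ proj₁) all , arcs)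
  stable-or-transitive (suc r) (suc t) {P} {x ∷ xs} (x≢ ∷ distinct) (px ∷ ps) (s≤s len)
      | inj₁ near≥ = go (filter-pigeonhole (arc? true x) (ramsey (suc r) t) (filter (Adj? x) xs) near≥)
    where
    near-distinct : AllPairs _≢_ (filter (Adj? x) xs)
    near-distinct = AllPairsₚ.filter⁺ (Adj? x) distinct

    go : ramsey (suc r) t ≤ length (filter (arc? true x) (filter (Adj? x) xs)) ⊎
         ramsey (suc r) t ≤ length (filter (¬? ∘ arc? true x) (filter (Adj? x) xs)) →
         Sublist P Stable (suc r) ⊎ Sublist P (Arc D) (suc t)
    go (inj₁ out≥) with stable-or-transitive (suc r) t (AllPairsₚ.filter⁺ (arc? true x) near-distinct)
                          (All-filter (arc? true x) (All-filter (Adj? x) ps)) out≥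
    ... | inj₁ (ys , len , all , stable) = inj₁ (ys , len , All.map (proj₁ ∘ proj₁) all , stable)
    ... | inj₂ (ys , len , all , arcs) =
          inj₂ (x ∷ ys , cong suc len , px ∷ All.map (proj₁ ∘ proj₁) all , All.map proj₂ all ∷ arcs)
    go (inj₂ in≥) with stable-or-transitive (suc r) t (AllPairsₚ.filter⁺ (¬? ∘ arc? true x) near-distinct)
                         (All-filter (¬? ∘ arc? true x) (All-filter (Adj? x) ps)) in≥
    ... | inj₁ (ys , len , all , stable) = inj₁ (ys , len , All.map (proj₁ ∘ proj₁) all , stable)
    -- In-neighbours of `x` precede it in the transitive order, so `x` goes last.
    ... | inj₂ (ys , len , all , arcs) =
          inj₂ (ys ++ x ∷ [] , trans (length-++ ys) (trans (+-comm (length ys) 1) (cong suc len)) ,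
                Allₚ.++⁺ (All.map (proj₁ ∘ proj₁) all) (px ∷ []) ,
                AllPairsₚ.++⁺ arcs ([] ∷ []) (All.map (λ ((_ , adj) , ¬out) → in-arc adj ¬out ∷ []) all))
      where
      in-arc : ∀ {y} → Adj x y → ¬ Arc D x y → Arc D y x
      in-arc (true  , a) ¬out = contradiction a ¬out
      in-arc (false , a) _    = a

  TTFree-nbhd : ∀ {t X x} b → X x → TTFree (suc t) X → TTFree t (λ v → X v × arc b x v)
  TTFree-nbhd {x = x} true xx free (ys , len , all , arcs) =
    free (x ∷ ys , cong suc len , xx ∷ All.map proj₁ all , All.map proj₂ all ∷ arcs)
  TTFree-nbhd {x = x} false xx free (ys , len , all , arcs) =
    free (ys ++ x ∷ [] , trans (length-++ ys) (trans (+-comm (length ys) 1) (cong suc len)) ,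
          Allₚ.++⁺ (All.map proj₁ all) (xx ∷ []) ,
          AllPairsₚ.++⁺ arcs ([] ∷ []) (All.map (λ (_ , a) → a ∷ []) all))

  Col⇒Dichromatic : ∀ {k X} → (∀ v → X v) → Col X (Fin k) → DichromaticAtMost D k
  Col⇒Dichromatic {k} {X} full (f , acyclic) = f , λ c cycle →
    let open CycleIn cycle in
    acyclic (vert zero) (closed-walk len vert
      (λ i → edge (trans (inP _) (sym (inP _))) (step i)) (edge (trans (inP _) (sym (inP _))) close))
    where
    edge : ∀ {u v} → f u ≡ f v → Arc D u v → Mono X f u v
    edge e a = full _ , full _ , e , a
    closed-walk : ∀ {R : V → V → Set} {z} k (vert : Fin (suc k) → V) →
                  (∀ i → R (vert (inject₁ i)) (vert (suc i))) → R (vert (fromℕ k)) z →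
                  TransClosure R (vert zero) z
    closed-walk zero vert step close = [ close ]
    closed-walk (suc k) vert step close = step zero ∷ closed-walk k (vert ∘ suc) (step ∘ suc) close

-- Recognising induced copies.

module _ {m n : ℕ} (H : Digraph m) (D : Digraph n) where
  private
    module H = Colouring H
    module D = Colouring D
  open Structure D using (Stable; arc⇒≢)

  -- Both arcs and distinctness are recorded to make the relation symmetric in the pair and to give
  -- `induced` its injectivity.
  Agree : Fin m → Fin m → Fin n → Fin n → Set
  Agree i j u v = (adj H i j ≡ adj D u v × adj H j i ≡ adj D v u) × u ≢ v

  Agree-sym : ∀ {i j u v} → Agree i j u v → Agree j i v u
  Agree-sym ((e , e′) , u≢v) = (e′ , e) , ≢-sym u≢v

  Agree-arc : ∀ b {i j u v} → H.arc b i j → D.arc b u v → Agree i j u v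
  Agree-arc true a a′ =
    (trans a (sym a′) , trans (oriented H _ _ a) (sym (oriented D _ _ a′))) , arc⇒≢ true a′
  Agree-arc false a a′ =
    (trans (oriented H _ _ a) (sym (oriented D _ _ a′)) , trans a (sym a′)) , arc⇒≢ false a′

  Agree-stable : ∀ {i j u v} → (adj H i j ∨ adj H j i) ≡ false → Stable u v → Agree i j u v
  Agree-stable {i} {j} {u} {v} ¬a (u≢v , ¬adj) with adj H i j | adj H j i
  Agree-stable {i} {j} {u} {v} ¬a (u≢v , ¬adj) | false | false =
    (false-of (λ a → ¬adj (true , a)) , false-of (λ a → ¬adj (false , a))) , u≢v
    where
    false-of : ∀ {b} → b ≢ true → false ≡ b
    false-of {true} ne = contradiction refl ne
    false-of {false} _ = refl
  Agree-stable () _ | true | _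
  Agree-stable () _ | false | true

  induced : (f : Fin m → Fin n) → (∀ i j → i ≡ j ⊎ Agree i j (f i) (f j)) → InducedIn H D
  induced f agree = f , f-inj , same
    where
    f-inj : Injective _≡_ _≡_ f
    f-inj {i} {j} e with agree i j
    ... | inj₁ i≡j = i≡j
    ... | inj₂ (_ , ne) = contradiction e ne
    same : ∀ i j → adj H i j ≡ adj D (f i) (f j)
    same i j with agree i j
    ... | inj₁ refl = trans (loopless H i) (sym (loopless D (f i)))
    ... | inj₂ ((e , _) , _) = e

TT-free : ∀ {n t} (D : Digraph n) → Free (TT t) D → ∀ {X} → Structure.TTFree D t X
TT-free D free (ys , refl , _ , arcs) = free (induced (TT _) D (lookup ys) agree)
  where
  earlier : ∀ i j → toℕ i < toℕ j → Agree (TT _) D i j (lookup ys i) (lookup ys j)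
  earlier i j i<j = Agree-arc (TT _) D true {i} {j} (Equivalence.to T-≡ (<⇒<ᵇ i<j)) (AllPairs-lookup arcs i j i<j)

  agree : ∀ i j → i ≡ j ⊎ Agree (TT _) D i j (lookup ys i) (lookup ys j)
  agree i j with <-cmp (toℕ i) (toℕ j)
  ... | tri< i<j _ _ = inj₂ (earlier i j i<j)
  ... | tri≈ _ i≡j _ = inj₁ (toℕ-injective i≡j)
  ... | tri> _ _ j<i = inj₂ (Agree-sym (TT _) D {j} {i} (earlier j i j<i))

module _ {n k : ℕ} (D : Digraph n) (H : Digraph (3 + k)) (isBroom : IsBroomOrientation k H) where
  open Colouring D
  open Structure D

  -- The leaves differ from `c` because `c` misses `v`, and from `x` because `x` is adjacent to `c`
  -- while they are not.
  broom-induced : ∀ a b l {c x v} →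
    Colouring.arc H a v₁ v₂ → Colouring.arc H b v₂ v₃ → (∀ i → Colouring.arc H l v₃ (w i)) →
    arc a c x → arc b x v → Stable c v →
    Sublist (λ u → arc l v u × ¬ Adj c u × ¬ Adj x u) Stable k → InducedIn H D
  broom-induced a b l {c} {x} {v} h₁₂ h₂₃ h₃ d₁₂ d₂₃ c-v (ys , refl , leaves , stable) =
    induced H D f agree
    where
    f : Fin (3 + k) → V
    f zero = c
    f (suc zero) = x
    f (suc (suc zero)) = v
    f (suc (suc (suc i))) = lookup ys i

    leaf : ∀ i → arc l v (lookup ys i) × ¬ Adj c (lookup ys i) × ¬ Adj x (lookup ys i)
    leaf i = All.lookup leaves (∈-lookup i)

    v₁-leaf : ∀ i → Agree H D v₁ (w i) c (lookup ys i)
    v₁-leaf i = let (d , ¬c , _) = leaf i in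
      Agree-stable H D (isBroom v₁ (w i))
        ((λ eq → proj₂ c-v (not l , subst (λ u → arc (not l) u v) (sym eq) (arc-sym l d))) , ¬c)

    v₂-leaf : ∀ i → Agree H D v₂ (w i) x (lookup ys i)
    v₂-leaf i = let (_ , ¬c , ¬x) = leaf i in
      Agree-stable H D (isBroom v₂ (w i)) ((λ eq → ¬c (a , subst (arc a c) eq d₁₂)) , ¬x)

    leaf-leaf : ∀ i j → i ≡ j ⊎ Agree H D (w i) (w j) (lookup ys i) (lookup ys j)
    leaf-leaf i j with <-cmp (toℕ i) (toℕ j)
    ... | tri< i<j _ _ = inj₂ (Agree-stable H D (isBroom (w i) (w j)) (AllPairs-lookup stable i j i<j))
    ... | tri≈ _ i≡j _ = inj₁ (toℕ-injective i≡j)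
    ... | tri> _ _ j<i =
          inj₂ (Agree-stable H D (isBroom (w i) (w j)) (Stable-sym (AllPairs-lookup stable j i j<i)))

    agree : ∀ i j → i ≡ j ⊎ Agree H D i j (f i) (f j)
    agree zero zero = inj₁ refl
    agree zero (suc zero) = inj₂ (Agree-arc H D a h₁₂ d₁₂)
    agree zero (suc (suc zero)) = inj₂ (Agree-stable H D (isBroom v₁ v₃) c-v)
    agree zero (suc (suc (suc j))) = inj₂ (v₁-leaf j)
    agree (suc zero) zero = inj₂ (Agree-sym H D (Agree-arc H D a h₁₂ d₁₂))
    agree (suc zero) (suc zero) = inj₁ refl
    agree (suc zero) (suc (suc zero)) = inj₂ (Agree-arc H D b h₂₃ d₂₃)
    agree (suc zero) (suc (suc (suc j))) = inj₂ (v₂-leaf j)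
    agree (suc (suc zero)) zero = inj₂ (Agree-sym H D (Agree-stable H D (isBroom v₁ v₃) c-v))
    agree (suc (suc zero)) (suc zero) = inj₂ (Agree-sym H D (Agree-arc H D b h₂₃ d₂₃))
    agree (suc (suc zero)) (suc (suc zero)) = inj₁ refl
    agree (suc (suc zero)) (suc (suc (suc j))) = inj₂ (Agree-arc H D l (h₃ j) (proj₁ (leaf j)))
    agree (suc (suc (suc i))) zero = inj₂ (Agree-sym H D (v₁-leaf i))
    agree (suc (suc (suc i))) (suc zero) = inj₂ (Agree-sym H D (v₂-leaf i))
    agree (suc (suc (suc i))) (suc (suc zero)) = inj₂ (Agree-sym H D (Agree-arc H D l (h₃ i) (proj₁ (leaf i))))
    agree (suc (suc (suc i))) (suc (suc (suc j))) with leaf-leaf i j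
    ... | inj₁ refl = inj₁ refl
    ... | inj₂ agr = inj₂ agr

-- Induction on the size of the excluded tournament.

-- Direction true carries the broom with v₂ → v₃, direction false the one with v₃ → v₂.
module _ (k : Bool → ℕ) (e l : Bool → Bool) where

  NoBroom : ∀ {n} → Digraph n → Set
  NoBroom D = ∀ {b c x v} → arc (e b) c x → arc b x v → Stable c v →
              ¬ Sublist (λ w → arc (l b) v w × ¬ Adj c w × ¬ Adj x w) Stable (k b)
    where
    open Colouring D
    open Structure D

  -- One `K` serves all digraphs. The palette `Fin (suc K)` is nonempty, which gives `gN` a default
  -- colour outside `X`.
  Colours : ℕ → Set₁
  Colours t = ∃ λ K → ∀ {n} (D : Digraph n) → NoBroom D →
              ∀ {X} → Decidable X → Structure.TTFree D t X → Colouring.Col D X (Fin (suc K))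

  module _ {K t : ℕ}
    (colourN : ∀ {n} (D : Digraph n) → NoBroom D →
               ∀ {X} → Decidable X → Structure.TTFree D t X → Colouring.Col D X (Fin (suc K)))
    where

    A : Set
    A = Fin (suc K) ⊎ Fin (suc K)

    ram : Bool → ℕ
    ram b = ramsey (k b) (suc t)

    N : ℕ
    N = ram true + ram false

    ram≤N : ∀ b → ram b ≤ N
    ram≤N true  = m≤m+n (ram true) (ram false)
    ram≤N false = m≤n+m (ram false) (ram true)

    colourX : ∀ {n} (D : Digraph n) → NoBroom D → ∀ {X} → Decidable X → Structure.TTFree D (suc t) X →
              Colouring.Col D X (FullColour A N)
    colourX {n} D noBroom {X} X? free =
      Decomposition.colour D l N e gN n X? gN-acyclic few (⊑-full X)
      where
      open Colouring D
      open Structure D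
      open Greedy D l N using (Good; few-neighbours)

      side : ∀ b {x} → X x → Col (λ v → X v × arc b x v) (Fin (suc K))
      side b {x} xx = colourN D noBroom (λ v → X? v ×-dec arc? b x v) (TTFree-nbhd b xx free)

      nbhd : ∀ {x} → X x → Col (λ v → X v × Adj x v) A
      nbhd {x} xx = Col-⊆ (λ { (xv , true , a) → inj₁ (xv , a) ; (xv , false , a) → inj₂ (xv , a) })
        (Col-∪ (λ v → X? v ×-dec arc? true x v) (side true xx) (side false xx))

      gN : V → V → A
      gN x with X? x
      ... | yes xx = proj₁ (nbhd xx)
      ... | no  _  = λ _ → inj₁ zero

      gN-acyclic : ∀ {x} → X x → Acyclic (Mono (λ v → X v × Adj x v) (gN x))
      gN-acyclic {x} xx with X? x
      ... | yes xx′ = proj₂ (nbhd xx′)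
      ... | no ¬xx  = contradiction xx ¬xx

      -- Among `N` such neighbours, Ramsey gives a stable set that completes broom `b`, or a
      -- transitive tournament on `suc t` vertices of `X`.
      few : ∀ {b c x v} → arc (e b) c x → arc b x v → ¬ Adj c v → c ≢ v →
            Good b v (λ w → X w × ¬ Adj c w × ¬ Adj x w)
      few {b} {c} {x} {v} d₁₂ d₂₃ ¬adj c≢v = few-neighbours λ (f , f-inj , h) →
        conclude (stable-or-transitive (k b) (suc t) (AllPairsₚ.tabulate⁺ (λ i≢j → i≢j ∘ f-inj))
          (Allₚ.tabulate⁺ h) (subst (ram b ≤_) (sym (length-tabulate f)) (ram≤N b)))
        where
        conclude : Sublist (λ w → (X w × ¬ Adj c w × ¬ Adj x w) × arc (l b) v w) Stable (k b) ⊎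
                   Sublist (λ w → (X w × ¬ Adj c w × ¬ Adj x w) × arc (l b) v w) (Arc D) (suc t) → ⊥
        conclude (inj₁ (ys , len , all , stable)) = noBroom d₁₂ d₂₃ (c≢v , ¬adj)
          (ys , len , All.map (λ ((_ , ¬c , ¬x) , a) → a , ¬c , ¬x) all , stable)
        conclude (inj₂ (ys , len , all , arcs)) = free (ys , len , All.map (proj₁ ∘ proj₁) all , arcs)

  colours : ∀ t → Colours t
  -- The empty list is a transitive tournament on no vertices, so the hypothesis is contradictory.
  colours zero = 0 , λ _ _ _ free → contradiction ([] , refl , [] , []) free
  colours (suc t) = let (K , colourN) = colours t in
    enough (Embeds-FullColour (Embeds-⊎ Embeds-Fin Embeds-Fin)) (colourX {K} {t} colourN)
    where
    enough : ∀ {B} → Embeds B → (∀ {n} (D : Digraph n) → NoBroom D → ∀ {X} → Decidable X →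
             Structure.TTFree D (suc t) X → Colouring.Col D X B) → Colours (suc t)
    enough (K , φ , φ-inj) col = K , λ D noBroom X? free →
      Colouring.Col-map D (suc ∘ φ) (φ-inj ∘ suc-injective) (col D noBroom X? free)

-- Reading off the directions of the brooms, and conclusion.

handle : ∀ {k} (H : Digraph (3 + k)) → IsBroomOrientation k H → ∃ λ a → Colouring.arc H a v₁ v₂
handle H isBroom with adj H v₁ v₂ in eq | isBroom v₁ v₂
... | true  | _ = true , eq
... | false | a = false , a

leaves : ∀ {k} (H : Digraph (3 + k)) → Valid k H → ∃ λ l → ∀ i → Colouring.arc H l v₃ (w i)
leaves H (inj₁ out) = true , out
leaves H (inj₂ in′) = false , in′

theorem1p16 : (r s t : ℕ) →
    (B : Digraph (3 + suc r)) (B' : Digraph (3 + suc s)) →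
    IsBroomOrientation (suc r) B → IsBroomOrientation (suc s) B' →
    Valid (suc r) B → Valid (suc s) B' →
    Opposing (suc r) (suc s) B B' →
    ChiFinite3 ⟨ 3 + suc r , B ⟩ ⟨ 3 + suc s , B' ⟩ ⟨ suc t , TT (suc t) ⟩
theorem1p16 r s t B B' isB isB' valid valid' (b₂₃ , b'₃₂)
  with handle B isB | handle B' isB' | leaves B valid | leaves B' valid'
... | a , h | a' , h' | l , ls | l' , ls' =
  let (K , col) = colours k e l″ (suc t)
  in suc K , λ n D B-free B'-free TT-free′ →
    Structure.Col⇒Dichromatic D {X = λ _ → ⊤} (λ _ → tt)
      (col D (λ { {true}  d₁₂ d₂₃ c-v ws → B-free (broom-induced D B isB a true l h b₂₃ ls d₁₂ d₂₃ c-v ws)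
                ; {false} d₁₂ d₂₃ c-v ws → B'-free (broom-induced D B' isB' a' false l' h' b'₃₂ ls' d₁₂ d₂₃ c-v ws) })
           (λ _ → yes tt) (TT-free D TT-free′))
  where
  k : Bool → ℕ
  k b = if b then suc r else suc s
  e l″ : Bool → Bool
  e b = if b then a else a'
  l″ b = if b then l else l'
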